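{- Let $\Gamma=\mathsf{PSL}_2(\mathbb{Z})=\langle U,S\mid U^3,S^2\rangle$, where $U$ has order $3$ and $S$ has order $2$. For integers $n,m\ge 0$ let $q(n,m)$ be the number of words in the alphabet $\{U,S\}$ containing exactly $n$ letters $U$ and $m$ letters $S$ which are equal to the identity in $\Gamma$ (the empty word counts, so $q(0,0)=1$). Let $$Q(x,y)=\sum_{n,m\ge 0}q(n,m)x^ny^m,\qquad T(x)=Q(x,x)=\sum_{n\ge0}t(n)x^n,$$ where $t(n)$ is the number of words of length $n$ in $\{U,S\}$ equal to the identity in $\Gamma$. Then $Q(x,y)$ is an algebraic function of degree $3$ over $\mathbb{Q}(x,y)$ satisfying $$(y^6-x^6+6y^2x^3-3y^4+2x^3+3y^2-1)Q^3+(x^3y^2-y^4+x^3+2y^2-1)Q^2+(x^3-y^2+1)Q+1=0.$$ In particular, $T(x)$ is an algebraic function of degree $3$ over $\mathbb{Q}(x)$ satisfying $$(6x^5-3x^4+2x^3+3x^2-1)T^3+(x^5-x^4+x^3+2x^2-1)T^2+(x^3-x^2+1)T+1=0.$$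
   Context: Words are finite sequences over the two-letter alphabet $\{U,S\}$, interpreted as products of the corresponding group elements in $\Gamma$. The generating functions are formal power series (convergent for small $|x|,|y|$). -}

module Defs where

open import Algebra.Bundles using (Group; RawRing)
import Algebra.Definitions.RawSemiring as RawSemiringDefinitions
open import Algebra.Morphism.Structures using (IsGroupHomomorphism; IsGroupIsomorphism)
import Algebra.Properties.Group as GroupProperties
open import Data.Fin.Base using (Fin; toℕ; fromℕ)
open import Data.Integer.Base as ℤ using (ℤ; +_; -[1+_]; +[1+_]; 0ℤ; 1ℤ; -1ℤ)
import Data.Integer.DivMod as ℤ
import Data.Integer.Properties as ℤ
open import Data.Integer.Tactic.RingSolver using (solve-∀)
open import Data.List.Base using (List; []; _∷_; length; filter; foldr; cartesianProductWith)
open import Data.Nat.Base as ℕ using (ℕ; zero; suc; _∸_; _≤_; _<_; z≤n; s≤s)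
open import Data.Nat.Induction using (<-wellFounded)
open import Data.Nat.Properties using (_≟_; m*n≡1⇒m≡1; m*n≡1⇒n≡1; +-suc; +-comm; +-identityʳ)
open import Data.Product.Base using (Σ; ∃; ∃-syntax; _,_; _×_; proj₁; proj₂)
import Data.Rational.Base as ℚ
open import Data.Sum.Base using (_⊎_; inj₁; inj₂)
open import Data.Vec.Functional using (Vector)
open import Function.Base using (_∘_)
open import Induction.WellFounded using (Acc; acc)
open import Level using (Level; _⊔_; 0ℓ)
open import Relation.Binary.PropositionalEquality
  using (_≡_; refl; sym; trans; cong; cong₂; subst)
open import Relation.Nullary using (¬_; Dec; yes; no)
open import Relation.Nullary.Decidable using (_×-dec_; map′)
open import Relation.Unary using (Pred; Decidable)

private
  variable
    c ℓ p : Level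

------------------------------------------------------------------------
-- Group presentations

data Term (X : Set) : Set where
  gen : X → Term X
  ε   : Term X
  _∙_ : Term X → Term X → Term X
  _⁻¹ : Term X → Term X

infixl 7 _∙_
infix  8 _⁻¹

-- ⟨ X ∣ R ⟩ is the group generated by X subject to r = 1 for every r in R:
-- group terms modulo the least congruence containing the group laws and R.
module Presentation (X : Set) (R : Pred (Term X) 0ℓ) where

  infix 4 _≈_

  data _≈_ : Term X → Term X → Set where
    ≈-refl    : ∀ {a} → a ≈ a
    ≈-sym     : ∀ {a b} → a ≈ b → b ≈ a
    ≈-trans   : ∀ {a b c} → a ≈ b → b ≈ c → a ≈ c
    ∙-cong    : ∀ {a a′ b b′} → a ≈ a′ → b ≈ b′ → a ∙ b ≈ a′ ∙ b′
    ⁻¹-cong   : ∀ {a a′} → a ≈ a′ → a ⁻¹ ≈ a′ ⁻¹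
    assoc     : ∀ a b c → (a ∙ b) ∙ c ≈ a ∙ (b ∙ c)
    identityˡ : ∀ a → ε ∙ a ≈ a
    identityʳ : ∀ a → a ∙ ε ≈ a
    inverseˡ  : ∀ a → a ⁻¹ ∙ a ≈ ε
    inverseʳ  : ∀ a → a ∙ a ⁻¹ ≈ ε
    relator   : ∀ {r} → R r → r ≈ ε

  group : Group 0ℓ 0ℓ
  group = record
    { Carrier = Term X
    ; _≈_     = _≈_
    ; _∙_     = _∙_
    ; ε       = ε
    ; _⁻¹     = _⁻¹
    ; isGroup = record
      { isMonoid = record
        { isSemigroup = record
          { isMagma = record
            { isEquivalence = record { refl = ≈-refl ; sym = ≈-sym ; trans = ≈-trans }
            ; ∙-cong = ∙-cong
            }
          ; assoc = assoc
          }
        ; identity = identityˡ , identityʳ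
        }
      ; inverse = inverseˡ , inverseʳ
      ; ⁻¹-cong = ⁻¹-cong
      }
    }

  module Eval (G : Group c ℓ) (f : X → Group.Carrier G) where
    private module G = Group G

    eval : Term X → G.Carrier
    eval (gen x) = f x
    eval ε       = G.ε
    eval (a ∙ b) = eval a G.∙ eval b
    eval (a ⁻¹)  = eval a G.⁻¹

    module _ (respects : ∀ {r} → R r → eval r G.≈ G.ε) where

      eval-cong : ∀ {a b} → a ≈ b → eval a G.≈ eval b
      eval-cong ≈-refl          = G.refl
      eval-cong (≈-sym h)       = G.sym (eval-cong h)
      eval-cong (≈-trans h k)   = G.trans (eval-cong h) (eval-cong k)
      eval-cong (∙-cong h k)    = G.∙-cong (eval-cong h) (eval-cong k)
      eval-cong (⁻¹-cong h)     = G.⁻¹-cong (eval-cong h)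
      eval-cong (assoc a b c)   = G.assoc _ _ _
      eval-cong (identityˡ a)   = G.identityˡ _
      eval-cong (identityʳ a)   = G.identityʳ _
      eval-cong (inverseˡ a)    = G.inverseˡ _
      eval-cong (inverseʳ a)    = G.inverseʳ _
      eval-cong (relator r)     = respects r

      isGroupHomomorphism : IsGroupHomomorphism (Group.rawGroup group) G.rawGroup eval
      isGroupHomomorphism = record
        { isMonoidHomomorphism = record
          { isMagmaHomomorphism = record
            { isRelHomomorphism = record { cong = eval-cong }
            ; homo = λ _ _ → G.refl
            }
          ; ε-homo = G.refl
          }
        ; ⁻¹-homo = λ _ → G.refl
        }

------------------------------------------------------------------------
-- Γ = ⟨ U , S ∣ U³ , S² ⟩

data Letter : Set where
  U S : Letter

data Relator : Pred (Term Letter) 0ℓ where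
  U³ : Relator (gen U ∙ gen U ∙ gen U)
  S² : Relator (gen S ∙ gen S)

module ΓPresentation = Presentation Letter Relator

Γ : Group 0ℓ 0ℓ
Γ = ΓPresentation.group

------------------------------------------------------------------------
-- The word problem in Γ, decided by normal forms

-- (i , a) stands for Uⁱ · a, with a a tail; a tail does not begin with U.
data Exponent : Set where
  e0 e1 e2 : Exponent

data Tail : Set where
  one lone-S : Tail
  su su²     : Tail → Tail

NF : Set
NF = Exponent × Tail

next : Exponent → Exponent
next e0 = e1
next e1 = e2
next e2 = e0

next³ : ∀ i → next (next (next i)) ≡ i
next³ e0 = refl
next³ e1 = refl
next³ e2 = refl

actU actS : NF → NF
actU (i , a)       = next i , a
actS (e0 , one)    = e0 , lone-S
actS (e0 , lone-S) = e0 , one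
actS (e0 , su a)   = e1 , a
actS (e0 , su² a)  = e2 , a
actS (e1 , a)      = e0 , su a
actS (e2 , a)      = e0 , su² a

actU³ : ∀ n → actU (actU (actU n)) ≡ n
actU³ (i , a) = cong (_, a) (next³ i)

actS² : ∀ n → actS (actS n) ≡ n
actS² (e0 , one)    = refl
actS² (e0 , lone-S) = refl
actS² (e0 , su a)   = refl
actS² (e0 , su² a)  = refl
actS² (e1 , a)      = refl
actS² (e2 , a)      = refl

act act⁻¹ : Term Letter → NF → NF
act (gen U) = actU
act (gen S) = actS
act ε       = λ n → n
act (a ∙ b) = act a ∘ act b
act (a ⁻¹)  = act⁻¹ a
act⁻¹ (gen U) = actU ∘ actU
act⁻¹ (gen S) = actS
act⁻¹ ε       = λ n → n
act⁻¹ (a ∙ b) = act⁻¹ b ∘ act⁻¹ a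
act⁻¹ (a ⁻¹)  = act a

act-act⁻¹ : ∀ a n → act a (act⁻¹ a n) ≡ n
act⁻¹-act : ∀ a n → act⁻¹ a (act a n) ≡ n
act-act⁻¹ (gen U) n = actU³ n
act-act⁻¹ (gen S) n = actS² n
act-act⁻¹ ε       n = refl
act-act⁻¹ (a ∙ b) n = trans (cong (act a) (act-act⁻¹ b (act⁻¹ a n))) (act-act⁻¹ a n)
act-act⁻¹ (a ⁻¹)  n = act⁻¹-act a n
act⁻¹-act (gen U) n = actU³ n
act⁻¹-act (gen S) n = actS² n
act⁻¹-act ε       n = refl
act⁻¹-act (a ∙ b) n = trans (cong (act⁻¹ b) (act⁻¹-act a (act b n))) (act⁻¹-act b n)
act⁻¹-act (a ⁻¹)  n = act-act⁻¹ a n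

module _ where
  open ΓPresentation

  act-cong : ∀ {a b} → a ≈ b → ∀ n → act a n ≡ act b n
  act-cong ≈-refl          n = refl
  act-cong (≈-sym h)       n = sym (act-cong h n)
  act-cong (≈-trans h k)   n = trans (act-cong h n) (act-cong k n)
  act-cong (∙-cong {a} {b = b} {b′} h k) n = trans (cong (act a) (act-cong k n)) (act-cong h (act b′ n))
  act-cong (⁻¹-cong {a} {a′} h) n =
    trans (cong (act⁻¹ a) (sym (act-act⁻¹ a′ n)))
      (trans (cong (act⁻¹ a) (sym (act-cong h (act⁻¹ a′ n)))) (act⁻¹-act a (act⁻¹ a′ n)))
  act-cong (assoc a b c)   n = refl
  act-cong (identityˡ a)   n = refl
  act-cong (identityʳ a)   n = refl
  act-cong (inverseˡ a)    n = act⁻¹-act a n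
  act-cong (inverseʳ a)    n = act-act⁻¹ a n
  act-cong (relator U³)    n = actU³ n
  act-cong (relator S²)    n = actS² n

  private
    u σ : Term Letter
    u = gen U
    σ = gen S

  reifyTail : Tail → Term Letter
  reifyTail one     = ε
  reifyTail lone-S  = σ
  reifyTail (su a)  = σ ∙ (u ∙ reifyTail a)
  reifyTail (su² a) = σ ∙ (u ∙ (u ∙ reifyTail a))

  reify : NF → Term Letter
  reify (e0 , a) = reifyTail a
  reify (e1 , a) = u ∙ reifyTail a
  reify (e2 , a) = u ∙ (u ∙ reifyTail a)

  private
    cancelU : ∀ a → u ∙ (u ∙ (u ∙ a)) ≈ a
    cancelU a = ≈-trans (≈-sym (assoc u u (u ∙ a)))
      (≈-trans (≈-sym (assoc (u ∙ u) u a))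
      (≈-trans (∙-cong (relator U³) ≈-refl) (identityˡ a)))

    cancelS : ∀ a → σ ∙ (σ ∙ a) ≈ a
    cancelS a = ≈-trans (≈-sym (assoc σ σ a))
      (≈-trans (∙-cong (relator S²) ≈-refl) (identityˡ a))

  reify-U : ∀ n → u ∙ reify n ≈ reify (actU n)
  reify-U (e0 , a) = ≈-refl
  reify-U (e1 , a) = ≈-refl
  reify-U (e2 , a) = cancelU _

  reify-S : ∀ n → σ ∙ reify n ≈ reify (actS n)
  reify-S (e0 , one)    = identityʳ σ
  reify-S (e0 , lone-S) = relator S²
  reify-S (e0 , su a)   = cancelS _
  reify-S (e0 , su² a)  = cancelS _
  reify-S (e1 , a)      = ≈-refl
  reify-S (e2 , a)      = ≈-refl

  reify-act   : ∀ t n → t ∙ reify n ≈ reify (act t n)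
  reify-act (gen U) n = reify-U n
  reify-act (gen S) n = reify-S n
  reify-act ε       n = identityˡ _
  reify-act (a ∙ b) n = ≈-trans (assoc a b _)
    (≈-trans (∙-cong ≈-refl (reify-act b n)) (reify-act a (act b n)))
  reify-act (a ⁻¹)  n = ≈-trans
    (∙-cong ≈-refl (≈-trans (subst (λ m → reify n ≈ reify m) (sym (act-act⁻¹ a n)) ≈-refl)
                            (≈-sym (reify-act a (act⁻¹ a n)))))
    (≈-trans (≈-sym (assoc (a ⁻¹) a _))
    (≈-trans (∙-cong (inverseˡ a) ≈-refl) (identityˡ _)))

  nf : Term Letter → NF
  nf t = act t (e0 , one)

  reify-nf : ∀ t → t ≈ reify (nf t)
  reify-nf t = ≈-trans (≈-sym (identityʳ t)) (reify-act t (e0 , one))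

  trivialNF? : (n : NF) → Dec (n ≡ (e0 , one))
  trivialNF? (e0 , one)    = yes refl
  trivialNF? (e0 , lone-S) = no λ ()
  trivialNF? (e0 , su _)   = no λ ()
  trivialNF? (e0 , su² _)  = no λ ()
  trivialNF? (e1 , _)      = no λ ()
  trivialNF? (e2 , _)      = no λ ()

  nf-trivial : ∀ t → nf t ≡ (e0 , one) → t ≈ ε
  nf-trivial t eq = ≈-trans (reify-nf t) (subst (λ n → reify n ≈ ε) (sym eq) ≈-refl)

  _≈ε? : ∀ t → Dec (t ≈ ε)
  t ≈ε? = map′ (nf-trivial t) (λ h → act-cong h (e0 , one)) (trivialNF? (nf t))

------------------------------------------------------------------------
-- The presented group Γ is PSL₂(ℤ), via U ↦ (0 -1 ; 1 1), S ↦ (0 -1 ; 1 0)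

record Mat : Set where
  constructor mat
  field
    m₁₁ m₁₂ m₂₁ m₂₂ : ℤ

module PSL where
  open import Data.Nat.Base using (_+_)
  open import Data.Integer.Base using () renaming (_+_ to _⊕_; _*_ to _⊗_; _-_ to _⊖_; -_ to ⊝_)
  open Mat

  mat-cong : ∀ {a a′ b b′ c c′ d d′} → a ≡ a′ → b ≡ b′ → c ≡ c′ → d ≡ d′ →
             mat a b c d ≡ mat a′ b′ c′ d′
  mat-cong refl refl refl refl = refl

  det : Mat → ℤ
  det (mat a b c d) = a ⊗ d ⊖ b ⊗ c

  I : Mat
  I = mat 1ℤ 0ℤ 0ℤ 1ℤ

  infixl 7 _⊡_
  _⊡_ : Mat → Mat → Mat
  mat a b c d ⊡ mat a′ b′ c′ d′ =
    mat (a ⊗ a′ ⊕ b ⊗ c′) (a ⊗ b′ ⊕ b ⊗ d′) (c ⊗ a′ ⊕ d ⊗ c′) (c ⊗ b′ ⊕ d ⊗ d′)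

  neg adj : Mat → Mat
  neg (mat a b c d) = mat (⊝ a) (⊝ b) (⊝ c) (⊝ d)
  adj (mat a b c d) = mat d (⊝ b) (⊝ c) a

  -- Equality in PSL₂ℤ: equality up to the sign ±1.
  infix 4 _∼_
  _∼_ : Mat → Mat → Set
  A ∼ B = A ≡ B ⊎ A ≡ neg B

  private
    assoc-entry : ∀ a b a′ b′ c′ d′ e f →
      (a ⊗ a′ ⊕ b ⊗ c′) ⊗ e ⊕ (a ⊗ b′ ⊕ b ⊗ d′) ⊗ f ≡ a ⊗ (a′ ⊗ e ⊕ b′ ⊗ f) ⊕ b ⊗ (c′ ⊗ e ⊕ d′ ⊗ f)
    assoc-entry = solve-∀

    negˡ-entry : ∀ a b e f → (⊝ a) ⊗ e ⊕ (⊝ b) ⊗ f ≡ ⊝ (a ⊗ e ⊕ b ⊗ f)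
    negˡ-entry = solve-∀

    negʳ-entry : ∀ a b e f → a ⊗ (⊝ e) ⊕ b ⊗ (⊝ f) ≡ ⊝ (a ⊗ e ⊕ b ⊗ f)
    negʳ-entry = solve-∀

    det-entries : ∀ a b c d a′ b′ c′ d′ →
      (a ⊗ a′ ⊕ b ⊗ c′) ⊗ (c ⊗ b′ ⊕ d ⊗ d′) ⊖ (a ⊗ b′ ⊕ b ⊗ d′) ⊗ (c ⊗ a′ ⊕ d ⊗ c′)
        ≡ (a ⊗ d ⊖ b ⊗ c) ⊗ (a′ ⊗ d′ ⊖ b′ ⊗ c′)
    det-entries = solve-∀

    first : ∀ e f → 1ℤ ⊗ e ⊕ 0ℤ ⊗ f ≡ e
    first = solve-∀

    second : ∀ e f → 0ℤ ⊗ e ⊕ 1ℤ ⊗ f ≡ f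
    second = solve-∀

    first′ : ∀ e f → e ⊗ 1ℤ ⊕ f ⊗ 0ℤ ≡ e
    first′ = solve-∀

    second′ : ∀ e f → e ⊗ 0ℤ ⊕ f ⊗ 1ℤ ≡ f
    second′ = solve-∀

    adj-det : ∀ a b c d → d ⊗ a ⊖ (⊝ b) ⊗ (⊝ c) ≡ a ⊗ d ⊖ b ⊗ c
    adj-det = solve-∀

    adjˡ₁ : ∀ a b c d → d ⊗ a ⊕ (⊝ b) ⊗ c ≡ a ⊗ d ⊖ b ⊗ c
    adjˡ₁ = solve-∀

    adjˡ₂ : ∀ b d → d ⊗ b ⊕ (⊝ b) ⊗ d ≡ 0ℤ
    adjˡ₂ = solve-∀

    adjˡ₃ : ∀ a c → (⊝ c) ⊗ a ⊕ a ⊗ c ≡ 0ℤ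
    adjˡ₃ = solve-∀

    adjˡ₄ : ∀ a b c d → (⊝ c) ⊗ b ⊕ a ⊗ d ≡ a ⊗ d ⊖ b ⊗ c
    adjˡ₄ = solve-∀

    adjʳ₁ : ∀ a b c d → a ⊗ d ⊕ b ⊗ (⊝ c) ≡ a ⊗ d ⊖ b ⊗ c
    adjʳ₁ = solve-∀

    adjʳ₂ : ∀ a b → a ⊗ (⊝ b) ⊕ b ⊗ a ≡ 0ℤ
    adjʳ₂ = solve-∀

    adjʳ₃ : ∀ c d → c ⊗ d ⊕ d ⊗ (⊝ c) ≡ 0ℤ
    adjʳ₃ = solve-∀

    adjʳ₄ : ∀ a b c d → c ⊗ (⊝ b) ⊕ d ⊗ a ≡ a ⊗ d ⊖ b ⊗ c
    adjʳ₄ = solve-∀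

  ⊡-assoc : ∀ A B C → (A ⊡ B) ⊡ C ≡ A ⊡ (B ⊡ C)
  ⊡-assoc (mat a b c d) (mat a′ b′ c′ d′) (mat e f g h) = mat-cong
    (assoc-entry a b a′ b′ c′ d′ e g) (assoc-entry a b a′ b′ c′ d′ f h)
    (assoc-entry c d a′ b′ c′ d′ e g) (assoc-entry c d a′ b′ c′ d′ f h)

  ⊡-identityˡ : ∀ A → I ⊡ A ≡ A
  ⊡-identityˡ (mat a b c d) = mat-cong (first a c) (first b d) (second a c) (second b d)

  ⊡-identityʳ : ∀ A → A ⊡ I ≡ A
  ⊡-identityʳ (mat a b c d) = mat-cong (first′ a b) (second′ a b) (first′ c d) (second′ c d)

  neg-neg : ∀ A → neg (neg A) ≡ A
  neg-neg (mat a b c d) = mat-cong (ℤ.neg-involutive a) (ℤ.neg-involutive b)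
                                   (ℤ.neg-involutive c) (ℤ.neg-involutive d)

  neg-⊡ˡ : ∀ A B → neg A ⊡ B ≡ neg (A ⊡ B)
  neg-⊡ˡ (mat a b c d) (mat e f g h) = mat-cong
    (negˡ-entry a b e g) (negˡ-entry a b f h) (negˡ-entry c d e g) (negˡ-entry c d f h)

  neg-⊡ʳ : ∀ A B → A ⊡ neg B ≡ neg (A ⊡ B)
  neg-⊡ʳ (mat a b c d) (mat e f g h) = mat-cong
    (negʳ-entry a b e g) (negʳ-entry a b f h) (negʳ-entry c d e g) (negʳ-entry c d f h)

  det-⊡ : ∀ A B → det (A ⊡ B) ≡ det A ⊗ det B
  det-⊡ (mat a b c d) (mat a′ b′ c′ d′) = det-entries a b c d a′ b′ c′ d′

  det-adj : ∀ A → det (adj A) ≡ det A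
  det-adj (mat a b c d) = adj-det a b c d

  adj-inverseˡ : ∀ A → det A ≡ 1ℤ → adj A ⊡ A ≡ I
  adj-inverseˡ (mat a b c d) h = mat-cong
    (trans (adjˡ₁ a b c d) h) (adjˡ₂ b d) (adjˡ₃ a c) (trans (adjˡ₄ a b c d) h)

  adj-inverseʳ : ∀ A → det A ≡ 1ℤ → A ⊡ adj A ≡ I
  adj-inverseʳ (mat a b c d) h = mat-cong
    (trans (adjʳ₁ a b c d) h) (adjʳ₂ a b) (adjʳ₃ c d) (trans (adjʳ₄ a b c d) h)

  ∼-refl : ∀ {A} → A ∼ A
  ∼-refl = inj₁ refl

  ∼-sym : ∀ {A B} → A ∼ B → B ∼ A
  ∼-sym         (inj₁ h) = inj₁ (sym h)
  ∼-sym {A} {B} (inj₂ h) = inj₂ (trans (sym (neg-neg B)) (cong neg (sym h)))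

  ∼-trans : ∀ {A B C} → A ∼ B → B ∼ C → A ∼ C
  ∼-trans (inj₁ refl) k           = k
  ∼-trans (inj₂ h)    (inj₁ refl) = inj₂ h
  ∼-trans (inj₂ h)    (inj₂ refl) = inj₁ (trans h (neg-neg _))

  ⊡-cong : ∀ {A A′ B B′} → A ∼ A′ → B ∼ B′ → A ⊡ B ∼ A′ ⊡ B′
  ⊡-cong (inj₁ refl) (inj₁ refl) = inj₁ refl
  ⊡-cong {A} {B′ = B′} (inj₁ refl) (inj₂ refl) = inj₂ (neg-⊡ʳ A B′)
  ⊡-cong {A′ = A′} {B} (inj₂ refl) (inj₁ refl) = inj₂ (neg-⊡ˡ A′ B)
  ⊡-cong {A′ = A′} {B′ = B′} (inj₂ refl) (inj₂ refl) =
    inj₁ (trans (neg-⊡ˡ A′ (neg B′)) (trans (cong neg (neg-⊡ʳ A′ B′)) (neg-neg (A′ ⊡ B′))))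

  adj-cong : ∀ {A A′} → A ∼ A′ → adj A ∼ adj A′
  adj-cong (inj₁ refl) = inj₁ refl
  adj-cong (inj₂ refl) = inj₂ refl

  SL₂ℤ : Set
  SL₂ℤ = Σ Mat λ A → det A ≡ 1ℤ

  PSL₂ℤ : Group 0ℓ 0ℓ
  PSL₂ℤ = record
    { Carrier = SL₂ℤ
    ; _≈_     = λ A B → proj₁ A ∼ proj₁ B
    ; _∙_     = λ { (A , h) (B , k) → A ⊡ B , trans (det-⊡ A B) (cong₂ _⊗_ h k) }
    ; ε       = I , refl
    ; _⁻¹     = λ { (A , h) → adj A , trans (det-adj A) h }
    ; isGroup = record
      { isMonoid = record
        { isSemigroup = record
          { isMagma = record
            { isEquivalence = record { refl = ∼-refl ; sym = ∼-sym ; trans = ∼-trans }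
            ; ∙-cong = ⊡-cong
            }
          ; assoc = λ A B C → inj₁ (⊡-assoc (proj₁ A) (proj₁ B) (proj₁ C))
          }
        ; identity = (λ A → inj₁ (⊡-identityˡ (proj₁ A))) , (λ A → inj₁ (⊡-identityʳ (proj₁ A)))
        }
      ; inverse = (λ { (A , h) → inj₁ (adj-inverseˡ A h) }) , (λ { (A , h) → inj₁ (adj-inverseʳ A h) })
      ; ⁻¹-cong = adj-cong
      }
    }

  matrix : Letter → SL₂ℤ
  matrix U = mat 0ℤ -1ℤ 1ℤ 1ℤ , refl
  matrix S = mat 0ℤ -1ℤ 1ℤ 0ℤ , refl

  open ΓPresentation
  open Eval PSL₂ℤ matrix public renaming (eval to toPSL₂ℤ)

  relators : ∀ {r} → Relator r → proj₁ (toPSL₂ℤ r) ∼ I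
  relators U³ = inj₂ refl
  relators S² = inj₂ refl

  private
    ⟪_⟫ : Term Letter → Mat
    ⟪ a ⟫ = proj₁ (toPSL₂ℤ a)

    ⟪⟫-cong : ∀ {a b} → a ≈ b → ⟪ a ⟫ ∼ ⟪ b ⟫
    ⟪⟫-cong = eval-cong relators

    MU MS : Mat
    MU = proj₁ (matrix U)
    MS = proj₁ (matrix S)

    su-entries : ∀ a b c d → MS ⊡ (MU ⊡ mat a b c d) ≡ neg (mat (a ⊕ c) (b ⊕ d) c d)
    su-entries a b c d = mat-cong (l₁ a c) (l₁ b d) (l₂ a c) (l₂ b d)
      where
      l₁ : ∀ a c → 0ℤ ⊗ (0ℤ ⊗ a ⊕ -1ℤ ⊗ c) ⊕ -1ℤ ⊗ (1ℤ ⊗ a ⊕ 1ℤ ⊗ c) ≡ ⊝ (a ⊕ c)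
      l₁ = solve-∀
      l₂ : ∀ a c → 1ℤ ⊗ (0ℤ ⊗ a ⊕ -1ℤ ⊗ c) ⊕ 0ℤ ⊗ (1ℤ ⊗ a ⊕ 1ℤ ⊗ c) ≡ ⊝ c
      l₂ = solve-∀

    su²-entries : ∀ a b c d → MS ⊡ (MU ⊡ (MU ⊡ mat a b c d)) ≡ neg (mat a b (a ⊕ c) (b ⊕ d))
    su²-entries a b c d = mat-cong (l₁ a c) (l₁ b d) (l₂ a c) (l₂ b d)
      where
      l₁ : ∀ a c → 0ℤ ⊗ (0ℤ ⊗ (0ℤ ⊗ a ⊕ -1ℤ ⊗ c) ⊕ -1ℤ ⊗ (1ℤ ⊗ a ⊕ 1ℤ ⊗ c))
                   ⊕ -1ℤ ⊗ (1ℤ ⊗ (0ℤ ⊗ a ⊕ -1ℤ ⊗ c) ⊕ 1ℤ ⊗ (1ℤ ⊗ a ⊕ 1ℤ ⊗ c)) ≡ ⊝ a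
      l₁ = solve-∀
      l₂ : ∀ a c → 1ℤ ⊗ (0ℤ ⊗ (0ℤ ⊗ a ⊕ -1ℤ ⊗ c) ⊕ -1ℤ ⊗ (1ℤ ⊗ a ⊕ 1ℤ ⊗ c))
                   ⊕ 0ℤ ⊗ (1ℤ ⊗ (0ℤ ⊗ a ⊕ -1ℤ ⊗ c) ⊕ 1ℤ ⊗ (1ℤ ⊗ a ⊕ 1ℤ ⊗ c)) ≡ ⊝ (a ⊕ c)
      l₂ = solve-∀

  -- Up to sign, SU and SU² act as (1 1 ; 0 1) and (1 0 ; 1 1), so the matrix of
  -- a tail is a nonnegative matrix with positive diagonal, times S if the tail
  -- ends in S.
  data Shape (a : Tail) : Set where
    even : ∀ p q r s → ⟪ reifyTail a ⟫ ∼ mat (+ suc p) (+ q) (+ r) (+ suc s) →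
           a ≡ one ⊎ 0 < q ⊎ 0 < r → Shape a
    odd  : ∀ p q r s → ⟪ reifyTail a ⟫ ∼ mat (+ q) -[1+ p ] (+ suc s) (⊝ (+ r)) → Shape a

  private
    su-shape : ∀ {A a b c d} → A ∼ mat a b c d → MS ⊡ (MU ⊡ A) ∼ mat (a ⊕ c) (b ⊕ d) c d
    su-shape {a = a} {b} {c} {d} h = ∼-trans
      (⊡-cong (∼-refl {MS}) (⊡-cong (∼-refl {MU}) h)) (inj₂ (su-entries a b c d))

    su²-shape : ∀ {A a b c d} → A ∼ mat a b c d → MS ⊡ (MU ⊡ (MU ⊡ A)) ∼ mat a b (a ⊕ c) (b ⊕ d)
    su²-shape {a = a} {b} {c} {d} h = ∼-trans
      (⊡-cong (∼-refl {MS}) (⊡-cong (∼-refl {MU}) (⊡-cong (∼-refl {MU}) h)))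
      (inj₂ (su²-entries a b c d))

    ∼-reflexive : ∀ {A B} → A ≡ B → A ∼ B
    ∼-reflexive = inj₁

    pos+suc : ∀ m n → + m ⊕ + suc n ≡ + suc (m + n)
    pos+suc m n = cong +_ (+-suc m n)

    neg+neg : ∀ m n → -[1+ m ] ⊕ (⊝ (+ n)) ≡ -[1+ m + n ]
    neg+neg m zero    = cong -[1+_] (sym (+-identityʳ m))
    neg+neg m (suc n) = cong -[1+_] (sym (+-suc m n))

  shape : ∀ a → Shape a
  shape one    = even 0 0 0 0 ∼-refl (inj₁ refl)
  shape lone-S = odd 0 0 0 0 ∼-refl
  shape (su a) with shape a
  ... | even p q r s h _ = even (p + r) (suc (q + s)) r s
    (∼-trans (su-shape h) (∼-reflexive (mat-cong refl (pos+suc q s) refl refl)))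
    (inj₂ (inj₁ (s≤s z≤n)))
  ... | odd p q r s h    = odd (p + r) (q + suc s) r s
    (∼-trans (su-shape h) (∼-reflexive (mat-cong refl (neg+neg p r) refl refl)))
  shape (su² a) with shape a
  ... | even p q r s h _ = even p q (suc (p + r)) (q + s)
    (∼-trans (su²-shape h) (∼-reflexive (mat-cong refl refl refl (pos+suc q s))))
    (inj₂ (inj₂ (s≤s z≤n)))
  ... | odd p q r s h    = odd p q (suc (p + r)) (q + s)
    (∼-trans (su²-shape h) (∼-reflexive (mat-cong refl refl (pos+suc q s) (neg+neg p r))))

  private
    off-diagonal : ∀ {A} → A ∼ I → m₁₂ A ≡ 0ℤ × m₂₁ A ≡ 0ℤ
    off-diagonal (inj₁ refl) = refl , refl
    off-diagonal (inj₂ refl) = refl , refl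

    via : ∀ {A B} (W : Mat) → A ∼ B → W ⊡ A ∼ I → m₁₂ (W ⊡ B) ≡ 0ℤ × m₂₁ (W ⊡ B) ≡ 0ℤ
    via W h k = off-diagonal (∼-trans (⊡-cong (∼-refl {W}) (∼-sym h)) k)

    via² : ∀ {A B} (V W : Mat) → A ∼ B → V ⊡ (W ⊡ A) ∼ I →
           m₁₂ (V ⊡ (W ⊡ B)) ≡ 0ℤ × m₂₁ (V ⊡ (W ⊡ B)) ≡ 0ℤ
    via² V W h k = via V (⊡-cong (∼-refl {W}) h) k

    row₁ : ∀ a c → 0ℤ ⊗ a ⊕ -1ℤ ⊗ c ≡ ⊝ c
    row₁ = solve-∀
    row₂ : ∀ a c → 1ℤ ⊗ a ⊕ 1ℤ ⊗ c ≡ a ⊕ c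
    row₂ = solve-∀
    row₁′ : ∀ a c → 0ℤ ⊗ (0ℤ ⊗ a ⊕ -1ℤ ⊗ c) ⊕ -1ℤ ⊗ (1ℤ ⊗ a ⊕ 1ℤ ⊗ c) ≡ ⊝ (a ⊕ c)
    row₁′ = solve-∀
    row₂′ : ∀ a c → 1ℤ ⊗ (0ℤ ⊗ a ⊕ -1ℤ ⊗ c) ⊕ 1ℤ ⊗ (1ℤ ⊗ a ⊕ 1ℤ ⊗ c) ≡ a
    row₂′ = solve-∀

  reify-trivial : ∀ n → ⟪ reify n ⟫ ∼ I → n ≡ (e0 , one)
  reify-trivial (i , a) k with shape a
  reify-trivial (e0 , a) k | even p q r s h (inj₁ refl) = refl
  reify-trivial (e0 , a) k | even p q r s h (inj₂ (inj₁ (s≤s _)))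
    with () ← proj₁ (off-diagonal (∼-trans (∼-sym h) k))
  reify-trivial (e0 , a) k | even p q r s h (inj₂ (inj₂ (s≤s _)))
    with () ← proj₂ (off-diagonal (∼-trans (∼-sym h) k))
  reify-trivial (e0 , a) k | odd p q r s h
    with () ← proj₁ (off-diagonal (∼-trans (∼-sym h) k))
  reify-trivial (e1 , a) k | even p q r s h _
    with () ← trans (sym (row₁ (+ q) (+ suc s))) (proj₁ (via MU h k))
  reify-trivial (e1 , a) k | odd p q r s h
    with () ← trans (sym (trans (row₂ (+ q) (+ suc s)) (pos+suc q s))) (proj₂ (via MU h k))
  reify-trivial (e2 , a) k | even p q r s h _
    with () ← trans (sym (row₂′ (+ suc p) (+ r))) (proj₂ (via² MU MU h k))
  reify-trivial (e2 , a) k | odd p q r s h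
    with () ← trans (sym (trans (row₁′ -[1+ p ] (⊝ (+ r))) (cong ⊝_ (neg+neg p r))))
                    (proj₁ (via² MU MU h k))

  kernel-trivial : ∀ a → ⟪ a ⟫ ∼ I → a ≈ ε
  kernel-trivial a h = nf-trivial a
    (reify-trivial (nf a) (∼-trans (⟪⟫-cong (≈-sym (reify-nf a))) h))

  toPSL₂ℤ-injective : ∀ {a b} → ⟪ a ⟫ ∼ ⟪ b ⟫ → a ≈ b
  toPSL₂ℤ-injective {a} {b} h = GroupProperties.x∙y⁻¹≈ε⇒x≈y Γ a b
    (kernel-trivial (a ∙ b ⁻¹)
      (∼-trans (⊡-cong h ∼-refl) (inj₁ (adj-inverseʳ ⟪ b ⟫ (proj₂ (toPSL₂ℤ b))))))

  private
    shear : ℕ → Term Letter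
    shear zero    = ε
    shear (suc n) = gen S ∙ (gen U ∙ shear n)

    shear-matrix : ∀ n → ⟪ shear n ⟫ ∼ mat 1ℤ (+ n) 0ℤ 1ℤ
    shear-matrix zero    = ∼-refl
    shear-matrix (suc n) = ∼-trans (su-shape (shear-matrix n))
      (inj₁ (mat-cong refl (cong +_ (+-comm n 1)) refl refl))

    shear± : ℤ → Term Letter
    shear± (+ n)    = shear n
    shear± -[1+ n ] = shear (suc n) ⁻¹

    shear±-matrix : ∀ n → ⟪ shear± n ⟫ ∼ mat 1ℤ n 0ℤ 1ℤ
    shear±-matrix (+ n)    = shear-matrix n
    shear±-matrix -[1+ n ] = adj-cong (shear-matrix (suc n))

    euclid-entries : ∀ n r b c d →
      mat 1ℤ n 0ℤ 1ℤ ⊡ (MS ⊡ mat c d (⊝ r) (n ⊗ d ⊖ b)) ≡ mat (r ⊕ n ⊗ c) b c d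
    euclid-entries n r b c d = mat-cong (l₁ n r c) (l₂ n b d) (l₃ r c) (l₄ n b d)
      where
      l₁ : ∀ n r c → 1ℤ ⊗ (0ℤ ⊗ c ⊕ -1ℤ ⊗ (⊝ r)) ⊕ n ⊗ (1ℤ ⊗ c ⊕ 0ℤ ⊗ (⊝ r)) ≡ r ⊕ n ⊗ c
      l₁ = solve-∀
      l₂ : ∀ n b d → 1ℤ ⊗ (0ℤ ⊗ d ⊕ -1ℤ ⊗ (n ⊗ d ⊖ b)) ⊕ n ⊗ (1ℤ ⊗ d ⊕ 0ℤ ⊗ (n ⊗ d ⊖ b)) ≡ b
      l₂ = solve-∀
      l₃ : ∀ r c → 0ℤ ⊗ (0ℤ ⊗ c ⊕ -1ℤ ⊗ (⊝ r)) ⊕ 1ℤ ⊗ (1ℤ ⊗ c ⊕ 0ℤ ⊗ (⊝ r)) ≡ c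
      l₃ = solve-∀
      l₄ : ∀ n b d → 0ℤ ⊗ (0ℤ ⊗ d ⊕ -1ℤ ⊗ (n ⊗ d ⊖ b)) ⊕ 1ℤ ⊗ (1ℤ ⊗ d ⊕ 0ℤ ⊗ (n ⊗ d ⊖ b)) ≡ d
      l₄ = solve-∀

    euclid-det : ∀ n r b c d → c ⊗ (n ⊗ d ⊖ b) ⊖ d ⊗ (⊝ r) ≡ (r ⊕ n ⊗ c) ⊗ d ⊖ b ⊗ c
    euclid-det = solve-∀

    upper-det : ∀ a b d → a ⊗ d ⊖ b ⊗ 0ℤ ≡ a ⊗ d
    upper-det = solve-∀

    units : ∀ a d → a ⊗ d ≡ 1ℤ → a ≡ 1ℤ × d ≡ 1ℤ ⊎ a ≡ -1ℤ × d ≡ -1ℤ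
    units a d h = go a d h (m*n≡1⇒m≡1 ℤ.∣ a ∣ ℤ.∣ d ∣ h′) (m*n≡1⇒n≡1 ℤ.∣ a ∣ ℤ.∣ d ∣ h′)
      where
      h′ = trans (sym (ℤ.abs-* a d)) (cong ℤ.∣_∣ h)
      go : ∀ a d → a ⊗ d ≡ 1ℤ → ℤ.∣ a ∣ ≡ 1 → ℤ.∣ d ∣ ≡ 1 → a ≡ 1ℤ × d ≡ 1ℤ ⊎ a ≡ -1ℤ × d ≡ -1ℤ
      go (+ 1)    (+ 1)    h refl refl = inj₁ (refl , refl)
      go -[1+ 0 ] -[1+ 0 ] h refl refl = inj₂ (refl , refl)
      go (+ 1)    -[1+ 0 ] () refl refl
      go -[1+ 0 ] (+ 1)    () refl refl

    upper : ∀ a b d → det (mat a b 0ℤ d) ≡ 1ℤ → ∃ λ t → ⟪ t ⟫ ∼ mat a b 0ℤ d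
    upper a b d h with units a d (trans (sym (upper-det a b d)) h)
    ... | inj₁ (refl , refl) = shear± b , shear±-matrix b
    ... | inj₂ (refl , refl) = shear± (⊝ b) , ∼-trans (shear±-matrix (⊝ b)) (inj₂ refl)

    reduce : ∀ a b c d .{{_ : ℤ.NonZero c}} → det (mat a b c d) ≡ 1ℤ →
      (∀ b′ r d′ → ℤ.∣ r ∣ < ℤ.∣ c ∣ → det (mat c b′ r d′) ≡ 1ℤ → ∃ λ t → ⟪ t ⟫ ∼ mat c b′ r d′) →
      ∃ λ t → ⟪ t ⟫ ∼ mat a b c d
    reduce a b c d h rec =
      let n  = a ℤ./ c
          r  = + (a ℤ.% c)
          a≡ = ℤ.a≡a%n+[a/n]*n a c
          t , k = rec d (⊝ r) (n ⊗ d ⊖ b)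
            (subst (_< ℤ.∣ c ∣) (sym (ℤ.∣-i∣≡∣i∣ r)) (ℤ.n%d<d a c))
            (trans (euclid-det n r b c d)
              (trans (cong (λ z → z ⊗ d ⊖ b ⊗ c) (sym a≡)) h))
      in shear± n ∙ (gen S ∙ t) ,
         ∼-trans (⊡-cong (shear±-matrix n) (⊡-cong (∼-refl {MS}) k))
           (inj₁ (trans (euclid-entries n r b c d) (mat-cong (sym a≡) refl refl refl)))

    euclid : ∀ a b c d → Acc _<_ ℤ.∣ c ∣ → det (mat a b c d) ≡ 1ℤ → ∃ λ t → ⟪ t ⟫ ∼ mat a b c d
    euclid a b (+ 0)       d _ h = upper a b d h
    euclid a b c@(+[1+ _ ]) d (acc rs) h =
      reduce a b c d h (λ b′ r d′ lt → euclid c b′ r d′ (rs lt))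
    euclid a b c@(-[1+ _ ]) d (acc rs) h =
      reduce a b c d h (λ b′ r d′ lt → euclid c b′ r d′ (rs lt))

  Γ≅PSL₂ℤ : IsGroupIsomorphism (Group.rawGroup Γ) (Group.rawGroup PSL₂ℤ) toPSL₂ℤ
  Γ≅PSL₂ℤ = record
    { isGroupMonomorphism = record
      { isGroupHomomorphism = isGroupHomomorphism relators
      ; injective           = toPSL₂ℤ-injective
      }
    ; surjective = λ { (mat a b c d , h) →
        let t , k = euclid a b c d (<-wellFounded ℤ.∣ c ∣) h
        in t , λ z≈t → ∼-trans (⟪⟫-cong z≈t) k }
    }

------------------------------------------------------------------------
-- Words

Word : Set
Word = List Letter

⟦_⟧ : Word → Group.Carrier Γ
⟦_⟧ = foldr (λ l t → gen l ∙ t) ε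

IsTrivial : Pred Word 0ℓ
IsTrivial w = Group._≈_ Γ ⟦ w ⟧ (Group.ε Γ)

trivial? : Decidable IsTrivial
trivial? w = ⟦ w ⟧ ≈ε?

#U #S : Word → ℕ
#U []      = 0
#U (U ∷ w) = suc (#U w)
#U (S ∷ w) = #U w
#S []      = 0
#S (U ∷ w) = #S w
#S (S ∷ w) = suc (#S w)

words : ℕ → List Word
words zero    = [] ∷ []
words (suc n) = cartesianProductWith _∷_ (U ∷ S ∷ []) (words n)

q : ℕ → ℕ → ℕ
q n m = length (filter (λ w → (#U w ≟ n) ×-dec (#S w ≟ m) ×-dec trivial? w) (words (n ℕ.+ m)))

t : ℕ → ℕ
t n = length (filter trivial? (words n))

------------------------------------------------------------------------
-- Formal power series

module RingOperations (A : RawRing c ℓ) where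
  open RawRing A public
  open RawSemiringDefinitions rawSemiring public using (_^_; sum) renaming (_×_ to _·_)

  infixl 6 _-_
  _-_ : Carrier → Carrier → Carrier
  a - b = a + (- b)

infix 9 _[[X]]

-- f : ℕ → A is the series Σ f n Xⁿ.
_[[X]] : RawRing c ℓ → RawRing c ℓ
A [[X]] = record
  { Carrier = ℕ → Carrier
  ; _≈_     = λ f g → ∀ n → f n ≈ g n
  ; _+_     = λ f g n → f n A.+ g n
  ; _*_     = λ f g n → sum {n = suc n} (λ i → f (toℕ i) A.* g (n ∸ toℕ i))
  ; -_      = λ f n → A.- f n
  ; 0#      = λ _ → 0#
  ; 1#      = λ { zero → 1# ; (suc _) → 0# }
  }
  where
  module A = RingOperations A
  open A using (Carrier; _≈_; 0#; 1#; sum)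

module _ (A : RawRing c ℓ) where
  open RawRing A

  X : RawRing.Carrier (A [[X]])
  X (suc zero) = 1#
  X _          = 0#

  constant : Carrier → RawRing.Carrier (A [[X]])
  constant a zero    = a
  constant a (suc _) = 0#

ℚ[[x]] : RawRing 0ℓ 0ℓ
ℚ[[x]] = ℚ.+-*-rawRing [[X]]

-- Realised as ℚ[[y]][[x]]: f n m is the coefficient of xⁿ yᵐ.
ℚ[[x,y]] : RawRing 0ℓ 0ℓ
ℚ[[x,y]] = ℚ[[x]] [[X]]

module Univariate where
  open RingOperations ℚ[[x]] public

  x : Carrier
  x = X ℚ.+-*-rawRing

  IsPolynomial : Pred Carrier 0ℓ
  IsPolynomial f = ∃[ N ] ∀ n → N ≤ n → f n ≡ ℚ.0ℚ

module Bivariate where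
  open RingOperations ℚ[[x,y]] public

  x y : Carrier
  x = X ℚ[[x]]
  y = constant ℚ[[x]] (X ℚ.+-*-rawRing)

  IsPolynomial : Pred Carrier 0ℓ
  IsPolynomial f = ∃[ N ] ∀ n m → N ≤ n ℕ.+ m → f n m ≡ ℚ.0ℚ

-- f ↦ f(x, x)
diagonal : Bivariate.Carrier → Univariate.Carrier
diagonal f n = RingOperations.sum ℚ.+-*-rawRing {n = suc n} (λ i → f (toℕ i) (n ∸ toℕ i))

------------------------------------------------------------------------
-- Algebraic functions

-- K is meant to be a subring of the integral domain A.  An element of A is
-- algebraic of degree d over the fraction field of K when d is the least
-- degree of a nonzero polynomial over that field vanishing at it; clearing
-- denominators, the coefficients may be taken in K, which avoids forming
-- the fraction fields.
module _ (A : RawRing c ℓ) (K : Pred (RawRing.Carrier A) p) where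
  open RingOperations A

  evaluate : ∀ {n} → Vector Carrier n → Carrier → Carrier
  evaluate P F = sum (λ i → P i * F ^ toℕ i)

  record IsAlgebraicOfDegree (d : ℕ) (F : Carrier) : Set (c ⊔ ℓ ⊔ p) where
    field
      P         : Vector Carrier (suc d)
      P-in-K    : ∀ i → K (P i)
      P-leading : ¬ P (fromℕ d) ≈ 0#
      P-root    : evaluate P F ≈ 0#
      minimal   : ∀ {e} → e < d → (R : Vector Carrier (suc e)) → (∀ i → K (R i)) →
                  evaluate R F ≈ 0# → ∀ i → R i ≈ 0#

------------------------------------------------------------------------
-- The generating functions

Q : Bivariate.Carrier
Q n m = + q n m ℚ./ 1

T : Univariate.Carrier
T n = + t n ℚ./ 1

{-# OPTIONS --safe #-}
module Submission where

-- Reading a word from the right, its letters act one after the other on the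
-- normal forms of Γ, so the generating functions Z_v of the words leading from 1
-- to v are the unique solution of Z_v = [v = 1] + x Z_(U⁻¹ v) + y Z_(S v).  Since Γ is a
-- free product, this solution is multiplicative along normal forms: with
-- s = y + x β s,  α = x + y s α,  β = x α + y s β,  g = 1 + (x β + y s) g
-- it is g times the product of the weights s, α, β of the syllables S, U, U².
-- Hence Q = g, and eliminating s, α, β leaves the cubic.  Restriction to x = y
-- is a ring homomorphism taking Q to T.
--
-- Minimality: if v₀ + v₁ Q + v₂ Q² = 0, then also N(v) = 0, where N(v) is the
-- determinant of v, Cv, C²v and C is multiplication by Q⁻¹ on the basis 1, Q, Q².
-- At x = y = 1, modulo 2, N becomes the norm form of the field 𝔽₈ = 𝔽₂[T]/(T³ + T + 1),
-- which has only the trivial zero.  So every polynomial solution v vanishes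
-- at x = 1 (respectively y = 1, modulo 2) and may be divided by 1 - x (1 - y, 2); by
-- infinite descent v = 0.

open import Algebra.Bundles using (CommutativeRing; RawRing)
import Algebra.Properties.AbelianGroup as AbelianGroupProperties
import Algebra.Properties.Ring as RingProperties
import Algebra.Properties.Semiring.Mult.TCOptimised as Mult
import Algebra.Solver.Ring
open import Algebra.Solver.Ring.AlmostCommutativeRing using (_-Raw-AlmostCommutative⟶_; fromCommutativeRing)
open import Data.Bool.Base using (Bool; true; false; _xor_; _∧_)
open import Data.Bool.Properties using (xor-∧-commutativeRing)
open import Data.Fin.Base using (zero; suc)
open import Data.Integer.Base as ℤ using (ℤ; +_; -[1+_]; _⊖_; ∣_∣)
import Data.Integer.DivMod as ℤ
import Data.Integer.Properties as ℤ
open import Data.Integer.Tactic.RingSolver using (solve-∀)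
open import Data.List.Base using (List; []; _∷_; length; filter; map; _++_)
import Data.List.Properties as List
import Data.List.Relation.Unary.All as All
open import Data.Maybe.Base using (Maybe; just; nothing)
open import Data.Nat.Base as ℕ using (ℕ; zero; suc; _∸_; _≤_; _<_; z≤n; s≤s)
import Data.Nat.Properties as ℕ
open import Data.Product.Base using (_×_; _,_; ∃-syntax; proj₁; proj₂)
import Data.Rational.Base as ℚ
import Data.Rational.Properties as ℚ
open import Data.Rational.Unnormalised.Base as ℚᵘ using (mkℚᵘ; *≡*)
import Data.Rational.Unnormalised.Properties as ℚᵘ
open import Data.Sum.Base using (_⊎_; inj₁; inj₂)
open import Data.Unit.Base using (⊤; tt)
open import Data.Vec.Functional using (Vector)
open import Function.Base using (_∘_)
open import Level using (Level; _⊔_; 0ℓ) renaming (suc to lsuc)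
open import Relation.Binary.PropositionalEquality as ≡ using (_≡_; cong; cong₂)
import Relation.Binary.Reasoning.Setoid as SetoidReasoning
open import Relation.Nullary using (¬_; yes; no; does)
open import Relation.Nullary.Decidable using (_×-dec_)
open import Relation.Unary using (Pred; Decidable; _≐_)

open import Defs

-- Degree 3 is usually read off from the irreducibility of the cubic, through Gauss's lemma and
-- fraction fields. Here everything stays inside the power series rings. `Q` itself cannot be
-- evaluated at x = 1, but N(v) no longer contains `Q`: it is a polynomial expression in v and the
-- coefficients of the cubic, so it can be specialised. Multiplying by Q⁻¹ rather than by Q keeps it
-- free of denominators: the constant coefficient of the cubic is 1, so Q⁻¹ is a polynomial in Q,
-- whereas reducing Q³ would divide by the leading coefficient.
--
-- The other three coefficients take the values 1, 2, 7 at x = y = 1, and their parities give T³ + T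
-- + 1, irreducible over 𝔽₂; this makes the point and the prime suitable. Rational denominators are
-- cleared by homogeneity of N before reducing modulo 2. The infinite descent is run as an induction
-- on a bound that drops with every division.
--
-- The degree of `T` is not inferred from that of `Q`, since a degree may drop on restriction to x =
-- y; the same values at x = y = 1 serve for both.

private
  variable
    c ℓ c′ ℓ′ κ κ′ r : Level

-- A ring solver with integer coefficients over any commutative ring

module IntegerSolver (R : CommutativeRing c ℓ) where
  open CommutativeRing R
  open RingProperties ring
  open AbelianGroupProperties +-abelianGroup using (⁻¹-∙-comm)
  open Mult semiring renaming (_×_ to _•_)
  open SetoidReasoning setoid

  -- With this multiple `1 • 1#` is `1#` itself and larger numerals are left-nested sums of `1#`, so
  -- `con (+ 1)` in a solver goal means `1#` definitionally.
  fromℤ : ℤ → Carrier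
  fromℤ (+ n)    = n • 1#
  fromℤ -[1+ n ] = - (suc n • 1#)

  fromℤ-⊖ : ∀ m n → fromℤ (m ⊖ n) ≈ m • 1# + - (n • 1#)
  fromℤ-⊖ m       zero    = sym (trans (+-congˡ -0#≈0#) (+-identityʳ _))
  fromℤ-⊖ zero    (suc n) = sym (+-identityˡ _)
  fromℤ-⊖ (suc m) (suc n) = begin
    fromℤ (suc m ⊖ suc n)               ≡⟨ cong fromℤ (ℤ.[1+m]⊖[1+n]≡m⊖n m n) ⟩
    fromℤ (m ⊖ n)                       ≈⟨ fromℤ-⊖ m n ⟩
    a + - b                             ≈⟨ +-congʳ (+-identityʳ a) ⟨
    a + 0# + - b                        ≈⟨ +-congʳ (+-congˡ (-‿inverseʳ 1#)) ⟨
    a + (1# + - 1#) + - b               ≈⟨ +-congʳ (+-assoc _ _ _) ⟨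
    a + 1# + - 1# + - b                 ≈⟨ +-assoc _ _ _ ⟩
    a + 1# + (- 1# + - b)               ≈⟨ +-cong (+-comm _ _) (⁻¹-∙-comm _ _) ⟩
    1# + a + - (1# + b)                 ≈⟨ +-cong (1+× m 1#) (-‿cong (1+× n 1#)) ⟨
    suc m • 1# + - (suc n • 1#)         ∎
    where
    a = m • 1#
    b = n • 1#

  fromℤ-neg : ∀ i → fromℤ (ℤ.- i) ≈ - fromℤ i
  fromℤ-neg (+ zero)  = sym -0#≈0#
  fromℤ-neg (+ suc n) = refl
  fromℤ-neg -[1+ n ]  = sym (-‿involutive _)

  fromℤ-+ : ∀ i j → fromℤ (i ℤ.+ j) ≈ fromℤ i + fromℤ j
  fromℤ-+ (+ m)    (+ n)    = ×-homo-+ 1# m n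
  fromℤ-+ (+ m)    -[1+ n ] = fromℤ-⊖ m (suc n)
  fromℤ-+ -[1+ m ] (+ n)    = trans (fromℤ-⊖ n (suc m)) (+-comm _ _)
  fromℤ-+ -[1+ m ] -[1+ n ] = trans
    (-‿cong (trans (reflexive (cong (_• 1#) (≡.cong suc (≡.sym (ℕ-+-suc m n))))) (×-homo-+ 1# (suc m) (suc n))))
    (sym (⁻¹-∙-comm _ _))
    where open import Data.Nat.Properties using () renaming (+-suc to ℕ-+-suc)

  fromℤ-*⁺ : ∀ m j → fromℤ (+ m ℤ.* j) ≈ fromℤ (+ m) * fromℤ j
  fromℤ-*⁺ m (+ n) = trans (reflexive (cong fromℤ (≡.sym (ℤ.pos-* m n)))) (×1-homo-* m n)
  fromℤ-*⁺ m -[1+ n ] = begin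
    fromℤ (+ m ℤ.* -[1+ n ])             ≡⟨ cong fromℤ (ℤ.neg-distribʳ-* (+ m) (+ suc n)) ⟨
    fromℤ (ℤ.- (+ m ℤ.* + suc n))        ≈⟨ fromℤ-neg (+ m ℤ.* + suc n) ⟩
    - fromℤ (+ m ℤ.* + suc n)            ≈⟨ -‿cong (fromℤ-*⁺ m (+ suc n)) ⟩
    - (m • 1# * (suc n • 1#))            ≈⟨ -‿distribʳ-* _ _ ⟩
    m • 1# * - (suc n • 1#)              ∎

  fromℤ-* : ∀ i j → fromℤ (i ℤ.* j) ≈ fromℤ i * fromℤ j
  fromℤ-* (+ m)    j = fromℤ-*⁺ m j
  fromℤ-* -[1+ m ] j = begin
    fromℤ (-[1+ m ] ℤ.* j)               ≡⟨ cong fromℤ (ℤ.neg-distribˡ-* (+ suc m) j) ⟨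
    fromℤ (ℤ.- (+ suc m ℤ.* j))          ≈⟨ fromℤ-neg (+ suc m ℤ.* j) ⟩
    - fromℤ (+ suc m ℤ.* j)              ≈⟨ -‿cong (fromℤ-*⁺ (suc m) j) ⟩
    - (suc m • 1# * fromℤ j)             ≈⟨ -‿distribˡ-* _ _ ⟩
    - (suc m • 1#) * fromℤ j             ∎

  morphism : ℤ.+-*-rawRing -Raw-AlmostCommutative⟶ fromCommutativeRing R
  morphism = record
    { ⟦_⟧    = fromℤ
    ; +-homo = fromℤ-+
    ; *-homo = fromℤ-*
    ; -‿homo = fromℤ-neg
    ; 0-homo = refl
    ; 1-homo = refl
    }

  private
    coeff≟ : ∀ i j → Maybe (fromℤ i ≈ fromℤ j)
    coeff≟ i j with i ℤ.≟ j
    ... | yes eq = just (reflexive (cong fromℤ eq))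
    ... | no _   = nothing

  open Algebra.Solver.Ring ℤ.+-*-rawRing (fromCommutativeRing R) morphism coeff≟ public
    using (Polynomial; con; solve; _:=_; _:+_; _:*_; _:-_; :-_)

-- The ring of formal power series

-- The inductions below rest on the definitional equality
-- (f * g) (suc n) = f 0 * g (suc n) + (f ∘ suc * g) n.
module PowerSeries (A : CommutativeRing c ℓ) where
  private module A = CommutativeRing A
  open RawRing (A.rawRing [[X]])
  open SetoidReasoning A.setoid
  open IntegerSolver A using (solve; _:=_; _:+_; _:*_; con)

  scale : A.Carrier → Carrier → Carrier
  scale a f n = a A.* f n

  *-cong : ∀ {f f′ g g′} → f ≈ f′ → g ≈ g′ → f * g ≈ f′ * g′
  *-cong p q zero    = A.+-congʳ (A.*-cong (p 0) (q 0))
  *-cong p q (suc n) = A.+-cong (A.*-cong (p 0) (q (suc n))) (*-cong (p ∘ suc) q n)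

  -- Needed for the convergence of fixed point iterations: a coefficient of a product sees no later
  -- coefficients of the factors.
  *-local : ∀ n {f f′ g g′} → (∀ i → i ≤ n → f i A.≈ f′ i) → (∀ i → i ≤ n → g i A.≈ g′ i) →
    (f * g) n A.≈ (f′ * g′) n
  *-local zero    h k = A.+-congʳ (A.*-cong (h 0 z≤n) (k 0 z≤n))
  *-local (suc n) h k = A.+-cong (A.*-cong (h 0 z≤n) (k (suc n) ℕ.≤-refl))
    (*-local n (λ i le → h (suc i) (s≤s le)) (λ i le → k i (ℕ.m≤n⇒m≤1+n le)))

  zeroˡ : ∀ f → 0# * f ≈ 0#
  zeroˡ f zero    = A.trans (A.+-identityʳ _) (A.zeroˡ _)
  zeroˡ f (suc n) = A.trans (A.+-cong (A.zeroˡ _) (zeroˡ f n)) (A.+-identityʳ _)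

  constant-* : ∀ a f → constant A.rawRing a * f ≈ scale a f
  constant-* a f zero    = A.+-identityʳ _
  constant-* a f (suc n) = A.trans (A.+-congˡ (zeroˡ f n)) (A.+-identityʳ _)

  scale-* : ∀ a f g → scale a f * g ≈ scale a (f * g)
  scale-* a f g zero    = solve 3 (λ a f g → a :* f :* g :+ con (+ 0) := a :* (f :* g :+ con (+ 0)))
    A.refl a (f 0) (g 0)
  scale-* a f g (suc n) = begin
    a A.* f 0 A.* g (suc n) A.+ (scale a (f ∘ suc) * g) n   ≈⟨ A.+-cong (A.*-assoc _ _ _) (scale-* a (f ∘ suc) g n) ⟩
    a A.* (f 0 A.* g (suc n)) A.+ a A.* (f ∘ suc * g) n     ≈⟨ A.distribˡ _ _ _ ⟨
    a A.* (f 0 A.* g (suc n) A.+ (f ∘ suc * g) n)           ∎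

  *-identityˡ : ∀ f → 1# * f ≈ f
  *-identityˡ f zero    = A.trans (A.+-identityʳ _) (A.*-identityˡ _)
  *-identityˡ f (suc n) = A.trans (A.+-cong (A.*-identityˡ _) (zeroˡ f n)) (A.+-identityʳ _)

  distribʳ : ∀ h f g → (f + g) * h ≈ f * h + g * h
  distribʳ h f g zero    = solve 3 (λ f g h → (f :+ g) :* h :+ con (+ 0) := (f :* h :+ con (+ 0)) :+ (g :* h :+ con (+ 0)))
    A.refl (f 0) (g 0) (h 0)
  distribʳ h f g (suc n) = A.trans (A.+-congˡ (distribʳ h (f ∘ suc) (g ∘ suc) n))
    (solve 5 (λ f g h a b → (f :+ g) :* h :+ (a :+ b) := (f :* h :+ a) :+ (g :* h :+ b))
      A.refl (f 0) (g 0) (h (suc n)) _ _)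

  -- The mirror image of the definitional recursion, splitting off the other end of the convolution;
  -- commutativity compares the two.
  *-suc : ∀ f g n → (f * g) (suc n) A.≈ (f * (g ∘ suc)) n A.+ f (suc n) A.* g 0
  *-suc f g zero    = solve 4 (λ a b c d → a :* b :+ (c :* d :+ con (+ 0)) := (a :* b :+ con (+ 0)) :+ c :* d)
    A.refl (f 0) (g 1) (f 1) (g 0)
  *-suc f g (suc n) = A.trans (A.+-congˡ (*-suc (f ∘ suc) g n)) (A.sym (A.+-assoc _ _ _))

  *-comm : ∀ f g → f * g ≈ g * f
  *-comm f g zero    = A.+-congʳ (A.*-comm _ _)
  *-comm f g (suc n) = begin
    f 0 A.* g (suc n) A.+ (f ∘ suc * g) n   ≈⟨ A.+-cong (A.*-comm _ _) (*-comm (f ∘ suc) g n) ⟩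
    g (suc n) A.* f 0 A.+ (g * (f ∘ suc)) n ≈⟨ A.+-comm _ _ ⟩
    (g * (f ∘ suc)) n A.+ g (suc n) A.* f 0 ≈⟨ *-suc g f n ⟨
    (g * f) (suc n)                         ∎

  *-assoc : ∀ f g h → (f * g) * h ≈ f * (g * h)
  *-assoc f g h zero    = solve 3
    (λ f g h → (f :* g :+ con (+ 0)) :* h :+ con (+ 0) := f :* (g :* h :+ con (+ 0)) :+ con (+ 0))
    A.refl (f 0) (g 0) (h 0)
  *-assoc f g h (suc n) = begin
    -- The tail of `f * g` is definitionally a sum of two series, so distributivity of series
    -- applies to it.
    (f 0 A.* g 0 A.+ A.0#) A.* h (suc n) A.+ ((scale (f 0) (g ∘ suc) + (f ∘ suc * g)) * h) n
      ≈⟨ A.+-congˡ (A.trans (distribʳ h (scale (f 0) (g ∘ suc)) (f ∘ suc * g) n)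
           (A.+-cong (scale-* (f 0) (g ∘ suc) h n) (*-assoc (f ∘ suc) g h n))) ⟩
    (f 0 A.* g 0 A.+ A.0#) A.* h (suc n) A.+ (f 0 A.* (g ∘ suc * h) n A.+ (f ∘ suc * (g * h)) n)
      ≈⟨ solve 5 (λ f g h a b → (f :* g :+ con (+ 0)) :* h :+ (f :* a :+ b) := f :* (g :* h :+ a) :+ b)
           A.refl (f 0) (g 0) (h (suc n)) _ _ ⟩
    (f * (g * h)) (suc n) ∎

  commutativeRing : CommutativeRing c ℓ
  commutativeRing = record
    { Carrier = Carrier
    ; _≈_     = _≈_
    ; _+_     = _+_
    ; _*_     = _*_
    ; -_      = -_
    ; 0#      = 0#
    ; 1#      = 1#
    ; isCommutativeRing = record
      { isRing = record
        { +-isAbelianGroup = record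
          { isGroup = record
            { isMonoid = record
              { isSemigroup = record
                { isMagma = record
                  { isEquivalence = record
                    { refl  = λ n → A.refl
                    ; sym   = λ p n → A.sym (p n)
                    ; trans = λ p q n → A.trans (p n) (q n)
                    }
                  ; ∙-cong = λ p q n → A.+-cong (p n) (q n)
                  }
                ; assoc = λ f g h n → A.+-assoc _ _ _
                }
              ; identity = (λ f n → A.+-identityˡ _) , λ f n → A.+-identityʳ _
              }
            ; inverse = (λ f n → A.-‿inverseˡ _) , λ f n → A.-‿inverseʳ _
            ; ⁻¹-cong = λ p n → A.-‿cong (p n)
            }
          ; comm = λ f g n → A.+-comm _ _
          }
        ; *-cong     = *-cong
        ; *-assoc    = *-assoc
        ; *-identity = *-identityˡ , λ f n → A.trans (*-comm f 1# n) (*-identityˡ f n)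
        ; distrib    = (λ f g h n → A.trans (*-comm f (g + h) n)
                         (A.trans (distribʳ f g h n) (A.+-cong (*-comm g f n) (*-comm h f n))))
                     , distribʳ
        }
      ; *-comm = *-comm
      }
    }

  X-*-zero : ∀ f → (X A.rawRing * f) 0 A.≈ A.0#
  X-*-zero f = A.trans (A.+-identityʳ _) (A.zeroˡ _)

  X-*-suc : ∀ f n → (X A.rawRing * f) (suc n) A.≈ f n
  X-*-suc f n = begin
    A.0# A.* f (suc n) A.+ (X A.rawRing ∘ suc * f) n
      ≈⟨ A.+-cong (A.zeroˡ _) (*-cong {X A.rawRing ∘ suc} {1#} {f} {f} (λ { zero → A.refl ; (suc _) → A.refl }) (λ _ → A.refl) n) ⟩
    A.0# A.+ (1# * f) n ≈⟨ A.trans (A.+-identityˡ _) (*-identityˡ f n) ⟩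
    f n ∎

-- The norm form of a cubic

module CubicNorm (R : CommutativeRing c ℓ) where
  open CommutativeRing R
  open IntegerSolver R using (solve; _:=_; _:+_; _:*_; _:-_; :-_; con)
  open SetoidReasoning setoid

  Triple : Set c
  Triple = Carrier × Carrier × Carrier

  Zero : Pred Triple ℓ
  Zero (v₀ , v₁ , v₂) = v₀ ≈ 0# × v₁ ≈ 0# × v₂ ≈ 0#

  value : Carrier → Triple → Carrier
  value θ (v₀ , v₁ , v₂) = v₀ + v₁ * θ + v₂ * (θ * θ)

  cubic : Triple → Carrier → Carrier
  cubic (p₁ , p₂ , p₃) θ = p₃ * (θ * (θ * θ)) + p₂ * (θ * θ) + p₁ * θ + 1#

  cubic-cong : ∀ p {θ φ} → θ ≈ φ → cubic p θ ≈ cubic p φ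
  cubic-cong p h = +-congʳ (+-cong (+-cong (*-congˡ (*-cong h (*-cong h h))) (*-congˡ (*-cong h h))) (*-congˡ h))

  -- v₀ + v₁ θ + v₂ θ² multiplied by θ⁻¹ = - (p₁ + p₂ θ + p₃ θ²).
  companion : Triple → Triple → Triple
  companion (p₁ , p₂ , p₃) (v₀ , v₁ , v₂) =
    v₁ - v₀ * p₁ , v₂ - v₀ * p₂ , - (v₀ * p₃)

  det : Triple → Triple → Triple → Carrier
  det (u₀ , u₁ , u₂) (v₀ , v₁ , v₂) (w₀ , w₁ , w₂) =
    u₀ * (v₁ * w₂ - v₂ * w₁) - v₀ * (u₁ * w₂ - u₂ * w₁) + w₀ * (u₁ * v₂ - u₂ * v₁)

  -- The columns are v, v θ⁻¹, v θ⁻² in the basis 1, θ, θ². For an irreducible cubic this is the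
  -- field norm of v times `norm p (1# , 0# , 0#)`, which is - p₃².
  norm : Triple → Triple → Carrier
  norm p v = det v (companion p v) (companion p (companion p v))

  scale : Carrier → Triple → Triple
  scale a (v₀ , v₁ , v₂) = a * v₀ , a * v₁ , a * v₂

  companion-value : ∀ p v θ → θ * value θ (companion p v) ≈ value θ v - proj₁ v * cubic p θ
  companion-value (p₁ , p₂ , p₃) (v₀ , v₁ , v₂) = solve 7
    (λ p₁ p₂ p₃ v₀ v₁ v₂ θ →
      θ :* ((v₁ :- v₀ :* p₁) :+ (v₂ :- v₀ :* p₂) :* θ :+ (:- (v₀ :* p₃)) :* (θ :* θ))
        := (v₀ :+ v₁ :* θ :+ v₂ :* (θ :* θ)) :-
           v₀ :* (p₃ :* (θ :* (θ :* θ)) :+ p₂ :* (θ :* θ) :+ p₁ :* θ :+ con (+ 1)))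
    refl p₁ p₂ p₃ v₀ v₁ v₂

  θ-inverse : ∀ p θ → cubic p θ ≈ 0# → - value θ p * θ ≈ 1#
  θ-inverse p@(p₁ , p₂ , p₃) θ h = begin
    - value θ p * θ               ≈⟨ solve 4 (λ p₁ p₂ p₃ θ →
      (:- (p₁ :+ p₂ :* θ :+ p₃ :* (θ :* θ))) :* θ
        := con (+ 1) :- (p₃ :* (θ :* (θ :* θ)) :+ p₂ :* (θ :* θ) :+ p₁ :* θ :+ con (+ 1)))
      refl p₁ p₂ p₃ θ ⟩
    1# - cubic p θ                ≈⟨ +-congˡ (-‿cong h) ⟩
    1# - 0#                       ≈⟨ solve 0 (con (+ 1) :- con (+ 0) := con (+ 1)) refl ⟩
    1#                            ∎

  -- `companion-value` only shows that θ times the value vanishes. The explicit inverse of θ removes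
  -- the factor without assuming the ring to be a domain.
  companion-root : ∀ p v θ → cubic p θ ≈ 0# → value θ v ≈ 0# → value θ (companion p v) ≈ 0#
  companion-root p v θ h k = begin
    w                               ≈⟨ *-identityˡ w ⟨
    1# * w                          ≈⟨ *-congʳ (θ-inverse p θ h) ⟨
    - value θ p * θ * w             ≈⟨ *-assoc _ _ _ ⟩
    - value θ p * (θ * w)           ≈⟨ *-congˡ (companion-value p v θ) ⟩
    - value θ p * (value θ v - proj₁ v * cubic p θ)
                                    ≈⟨ *-congˡ (+-cong k (-‿cong (*-congˡ h))) ⟩
    - value θ p * (0# - proj₁ v * 0#)
      ≈⟨ solve 2 (λ x y → x :* (con (+ 0) :- y :* con (+ 0)) := con (+ 0)) refl _ _ ⟩
    0#                              ∎
    where w = value θ (companion p v)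

  -- Adding θ times the second row and θ² times the third to the first does not change the
  -- determinant and turns the first row into the three values.
  det-value : ∀ u v w θ → value θ u ≈ 0# → value θ v ≈ 0# → value θ w ≈ 0# → det u v w ≈ 0#
  det-value u@(u₀ , u₁ , u₂) v@(v₀ , v₁ , v₂) w@(w₀ , w₁ , w₂) θ h k l = begin
    det u v w ≈⟨ solve 10 (λ u₀ u₁ u₂ v₀ v₁ v₂ w₀ w₁ w₂ θ →
      u₀ :* (v₁ :* w₂ :- v₂ :* w₁) :- v₀ :* (u₁ :* w₂ :- u₂ :* w₁) :+ w₀ :* (u₁ :* v₂ :- u₂ :* v₁)
        := (u₀ :+ u₁ :* θ :+ u₂ :* (θ :* θ)) :* (v₁ :* w₂ :- v₂ :* w₁)
        :- (v₀ :+ v₁ :* θ :+ v₂ :* (θ :* θ)) :* (u₁ :* w₂ :- u₂ :* w₁)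
        :+ (w₀ :+ w₁ :* θ :+ w₂ :* (θ :* θ)) :* (u₁ :* v₂ :- u₂ :* v₁))
      refl u₀ u₁ u₂ v₀ v₁ v₂ w₀ w₁ w₂ θ ⟩
    value θ u * (v₁ * w₂ - v₂ * w₁) - value θ v * (u₁ * w₂ - u₂ * w₁) + value θ w * (u₁ * v₂ - u₂ * v₁)
      ≈⟨ +-cong (+-cong (*-congʳ h) (-‿cong (*-congʳ k))) (*-congʳ l) ⟩
    0# * (v₁ * w₂ - v₂ * w₁) - 0# * (u₁ * w₂ - u₂ * w₁) + 0# * (u₁ * v₂ - u₂ * v₁)
      ≈⟨ solve 3 (λ x y z → con (+ 0) :* x :- con (+ 0) :* y :+ con (+ 0) :* z := con (+ 0)) refl _ _ _ ⟩
    0# ∎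

  norm-root : ∀ p v θ → cubic p θ ≈ 0# → value θ v ≈ 0# → norm p v ≈ 0#
  norm-root p v θ h k = det-value _ _ _ θ k k₁ (companion-root p _ θ h k₁)
    where k₁ = companion-root p v θ h k

  det-cong : ∀ {u₀ u₁ u₂ v₀ v₁ v₂ w₀ w₁ w₂ u₀′ u₁′ u₂′ v₀′ v₁′ v₂′ w₀′ w₁′ w₂′} →
    u₀ ≈ u₀′ → u₁ ≈ u₁′ → u₂ ≈ u₂′ → v₀ ≈ v₀′ → v₁ ≈ v₁′ → v₂ ≈ v₂′ → w₀ ≈ w₀′ → w₁ ≈ w₁′ → w₂ ≈ w₂′ →
    det (u₀ , u₁ , u₂) (v₀ , v₁ , v₂) (w₀ , w₁ , w₂) ≈ det (u₀′ , u₁′ , u₂′) (v₀′ , v₁′ , v₂′) (w₀′ , w₁′ , w₂′)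
  det-cong a b c d e f g h i = +-cong
    (+-cong (*-cong a (+-cong (*-cong e i) (-‿cong (*-cong f h))))
            (-‿cong (*-cong d (+-cong (*-cong b i) (-‿cong (*-cong c h))))))
    (*-cong g (+-cong (*-cong b f) (-‿cong (*-cong c e))))

  norm-cong : ∀ p {v₀ v₁ v₂ w₀ w₁ w₂} → v₀ ≈ w₀ → v₁ ≈ w₁ → v₂ ≈ w₂ →
    norm p (v₀ , v₁ , v₂) ≈ norm p (w₀ , w₁ , w₂)
  norm-cong p h₀ h₁ h₂ = det-cong h₀ h₁ h₂ c₀ c₁ c₂
    (companion-cong₀ c₀ c₁) (companion-cong₀ c₀ c₂) (companion-cong₂ c₀)
    where
    companion-cong₀ : ∀ {x y z w q} → x ≈ y → z ≈ w → z - x * q ≈ w - y * q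
    companion-cong₀ h k = +-cong k (-‿cong (*-congʳ h))
    companion-cong₂ : ∀ {x y q} → x ≈ y → - (x * q) ≈ - (y * q)
    companion-cong₂ h = -‿cong (*-congʳ h)
    c₀ = companion-cong₀ h₀ h₁
    c₁ = companion-cong₀ h₀ h₂
    c₂ = companion-cong₂ h₀

  -- `companion` is linear and `det` is trilinear. This homogeneity is used twice: to divide a zero
  -- of the norm in the descent and to clear rational denominators.
  norm-scale : ∀ p a v → norm p (scale a v) ≈ a * (a * (a * norm p v))
  norm-scale (p₁ , p₂ , p₃) a (v₀ , v₁ , v₂) = begin
    norm p (scale a v)
      ≈⟨ det-cong refl refl refl (lin v₁ v₀ p₁) (lin v₂ v₀ p₂) (neg v₀ p₃)
           (lin′ p₁ (lin v₂ v₀ p₂) (lin v₁ v₀ p₁))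
           (lin′ p₂ (neg v₀ p₃) (lin v₁ v₀ p₁))
           (trans (-‿cong (*-congʳ (lin v₁ v₀ p₁))) (neg (v₁ - v₀ * p₁) p₃)) ⟩
    det (scale a v) (scale a (companion p v)) (scale a (companion p (companion p v)))
      ≈⟨ det-scale _ _ _ _ _ _ _ _ _ ⟩
    a * (a * (a * norm p v)) ∎
    where
    p = p₁ , p₂ , p₃
    v = v₀ , v₁ , v₂
    lin : ∀ x y z → a * x - a * y * z ≈ a * (x - y * z)
    lin = solve 4 (λ a x y z → a :* x :- a :* y :* z := a :* (x :- y :* z)) refl a
    neg : ∀ y z → - (a * y * z) ≈ a * - (y * z)
    neg = solve 3 (λ a y z → :- (a :* y :* z) := a :* (:- (y :* z))) refl a
    lin′ : ∀ {x x′ y y′} z → x′ ≈ a * x → y′ ≈ a * y → x′ - y′ * z ≈ a * (x - y * z)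
    lin′ z h k = trans (+-cong h (-‿cong (*-congʳ k))) (lin _ _ z)
    det-scale : ∀ u₀ u₁ u₂ v₀ v₁ v₂ w₀ w₁ w₂ →
      det (scale a (u₀ , u₁ , u₂)) (scale a (v₀ , v₁ , v₂)) (scale a (w₀ , w₁ , w₂))
        ≈ a * (a * (a * det (u₀ , u₁ , u₂) (v₀ , v₁ , v₂) (w₀ , w₁ , w₂)))
    det-scale = solve 10 (λ a u₀ u₁ u₂ v₀ v₁ v₂ w₀ w₁ w₂ →
      a :* u₀ :* (a :* v₁ :* (a :* w₂) :- a :* v₂ :* (a :* w₁))
        :- a :* v₀ :* (a :* u₁ :* (a :* w₂) :- a :* u₂ :* (a :* w₁))
        :+ a :* w₀ :* (a :* u₁ :* (a :* v₂) :- a :* u₂ :* (a :* v₁))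
      := a :* (a :* (a :* (u₀ :* (v₁ :* w₂ :- v₂ :* w₁) :- v₀ :* (u₁ :* w₂ :- u₂ :* w₁)
            :+ w₀ :* (u₁ :* v₂ :- u₂ :* v₁))))) refl a

  -- A record, so that its instances are compared by their parameters: over power
  -- series, comparing the unfolded equations coefficientwise is infeasible.
  record Anisotropic (K : Pred Carrier κ) (p : Triple) : Set (c ⊔ ℓ ⊔ κ) where
    constructor anisotropic
    field
      norm-zero : ∀ v₀ v₁ v₂ → K v₀ → K v₁ → K v₂ → norm p (v₀ , v₁ , v₂) ≈ 0# → Zero (v₀ , v₁ , v₂)

  open Anisotropic public

  anisotropic-⊆ : ∀ {K : Pred Carrier κ} {L : Pred Carrier κ′} {p} → (∀ v → K v → L v) → Anisotropic L p → Anisotropic K p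
  anisotropic-⊆ h an = anisotropic λ v₀ v₁ v₂ k₀ k₁ k₂ → norm-zero an v₀ v₁ v₂ (h v₀ k₀) (h v₁ k₁) (h v₂ k₂)

-- Specialisations and descent

-- The graph of a ring homomorphism defined on a subring of B.
record Specialisation (B : CommutativeRing c ℓ) (A : CommutativeRing c′ ℓ′) r : Set (c ⊔ ℓ ⊔ c′ ⊔ ℓ′ ⊔ lsuc r) where
  private
    module B = CommutativeRing B
    module A = CommutativeRing A
  infix 4 _⇝_
  field
    _⇝_  : B.Carrier → A.Carrier → Set r
    +-⇝  : ∀ {f g a b} → f ⇝ a → g ⇝ b → f B.+ g ⇝ a A.+ b
    *-⇝  : ∀ {f g a b} → f ⇝ a → g ⇝ b → f B.* g ⇝ a A.* b
    -‿⇝  : ∀ {f a} → f ⇝ a → B.- f ⇝ A.- a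
    zero-⇝ : ∀ {f a} → f ⇝ a → f B.≈ B.0# → a A.≈ A.0#

  minus-⇝ : ∀ {f g a b} → f ⇝ a → g ⇝ b → f B.- g ⇝ a A.- b
  minus-⇝ h k = +-⇝ h (-‿⇝ k)

module _ {B : CommutativeRing c ℓ} {A : CommutativeRing c′ ℓ′} (S : Specialisation B A r) where
  private
    module B where
      open CommutativeRing B public
      open CubicNorm B public
    module A where
      open CommutativeRing A public
      open CubicNorm A public
  open Specialisation S

  norm-⇝ : ∀ {p₁ p₂ p₃ v₀ v₁ v₂ q₁ q₂ q₃ w₀ w₁ w₂} → p₁ ⇝ q₁ → p₂ ⇝ q₂ → p₃ ⇝ q₃ →
    v₀ ⇝ w₀ → v₁ ⇝ w₁ → v₂ ⇝ w₂ →
    B.norm (p₁ , p₂ , p₃) (v₀ , v₁ , v₂) ⇝ A.norm (q₁ , q₂ , q₃) (w₀ , w₁ , w₂)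
  norm-⇝ h₁ h₂ h₃ k₀ k₁ k₂ = det-⇝ k₀ k₁ k₂ l₀ l₁ l₂ (comp l₀ l₁ h₁) (comp l₀ l₂ h₂) (-‿⇝ (*-⇝ l₀ h₃))
    where
    comp : ∀ {x y p x′ y′ p′} → x ⇝ x′ → y ⇝ y′ → p ⇝ p′ → y B.- x B.* p ⇝ y′ A.- x′ A.* p′
    comp h k l = minus-⇝ k (*-⇝ h l)
    l₀ = comp k₀ k₁ h₁
    l₁ = comp k₀ k₂ h₂
    l₂ = -‿⇝ (*-⇝ k₀ h₃)
    det-⇝ : ∀ {u₀ u₁ u₂ v₀ v₁ v₂ w₀ w₁ w₂ u₀′ u₁′ u₂′ v₀′ v₁′ v₂′ w₀′ w₁′ w₂′} →
      u₀ ⇝ u₀′ → u₁ ⇝ u₁′ → u₂ ⇝ u₂′ → v₀ ⇝ v₀′ → v₁ ⇝ v₁′ → v₂ ⇝ v₂′ → w₀ ⇝ w₀′ → w₁ ⇝ w₁′ → w₂ ⇝ w₂′ →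
      B.det (u₀ , u₁ , u₂) (v₀ , v₁ , v₂) (w₀ , w₁ , w₂) ⇝ A.det (u₀′ , u₁′ , u₂′) (v₀′ , v₁′ , v₂′) (w₀′ , w₁′ , w₂′)
    det-⇝ a b c d e f g h i = +-⇝
      (minus-⇝ (*-⇝ a (minus-⇝ (*-⇝ e i) (*-⇝ f h))) (*-⇝ d (minus-⇝ (*-⇝ b i) (*-⇝ c h))))
      (*-⇝ g (minus-⇝ (*-⇝ b f) (*-⇝ c e)))

  module Descent
    (K : Pred A.Carrier κ)
    (Bounded : ℕ → Pred B.Carrier κ′)
    (π : B.Carrier)
    (π-cancel : ∀ f → π B.* f B.≈ B.0# → f B.≈ B.0#)
    (bounded-zero : ∀ {f} → Bounded 0 f → f B.≈ B.0#)
    (specialise : ∀ {n f} → Bounded (suc n) f → ∃[ a ] K a × f ⇝ a ×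
                  (a A.≈ A.0# → ∃[ g ] Bounded n g × f B.≈ π B.* g))
    where

    -- If the norm of v vanishes, so does the norm of its specialisation, which is therefore the
    -- zero triple; hence v = π g with a smaller bound for g. By homogeneity π³ times the norm of g
    -- is 0, and after three cancellations the induction hypothesis applies to g. Bound 0 admits
    -- only 0.
    anisotropic-lift : ∀ {p₁ p₂ p₃ q₁ q₂ q₃} → p₁ ⇝ q₁ → p₂ ⇝ q₂ → p₃ ⇝ q₃ →
      A.Anisotropic K (q₁ , q₂ , q₃) → ∀ n → B.Anisotropic (Bounded n) (p₁ , p₂ , p₃)
    anisotropic-lift s₁ s₂ s₃ an zero = B.anisotropic λ v₀ v₁ v₂ b₀ b₁ b₂ _ →
      bounded-zero b₀ , bounded-zero b₁ , bounded-zero b₂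
    anisotropic-lift {p₁} {p₂} {p₃} s₁ s₂ s₃ an (suc n) = B.anisotropic λ v₀ v₁ v₂ b₀ b₁ b₂ h →
      let a₀ , k₀ , t₀ , d₀ = specialise b₀
          a₁ , k₁ , t₁ , d₁ = specialise b₁
          a₂ , k₂ , t₂ , d₂ = specialise b₂
          z₀ , z₁ , z₂ = A.norm-zero an a₀ a₁ a₂ k₀ k₁ k₂ (zero-⇝ (norm-⇝ s₁ s₂ s₃ t₀ t₁ t₂) h)
          g₀ , c₀ , e₀ = d₀ z₀
          g₁ , c₁ , e₁ = d₁ z₁
          g₂ , c₂ , e₂ = d₂ z₂
          p = p₁ , p₂ , p₃
          y₀ , y₁ , y₂ = B.norm-zero (anisotropic-lift s₁ s₂ s₃ an n) g₀ g₁ g₂ c₀ c₁ c₂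
            (π-cancel _ (π-cancel _ (π-cancel _
              (B.trans (B.sym (B.norm-scale p π (g₀ , g₁ , g₂)))
              (B.trans (B.sym (B.norm-cong p e₀ e₁ e₂)) h)))))
          vanish : ∀ {v g} → v B.≈ π B.* g → g B.≈ B.0# → v B.≈ B.0#
          vanish e y = B.trans e (B.trans (B.*-congˡ y) (B.zeroʳ π))
      in vanish e₀ y₀ , vanish e₁ y₁ , vanish e₂ y₂

-- Remainders, finite support and evaluation at 1

-- Residues modulo π, with a and a′ the remainders of f and f′.
module RemainderArithmetic (R : CommutativeRing c ℓ) where
  open CommutativeRing R
  open IntegerSolver R using (solve; _:=_; _:+_; _:*_; :-_)

  remainder-+ : ∀ π f a g f′ a′ g′ {b} → f ≈ a + π * g → f′ ≈ a′ + π * g′ → a + a′ ≈ b →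
                f + f′ ≈ b + π * (g + g′)
  remainder-+ π f a g f′ a′ g′ h h′ k = trans (+-cong h h′) (trans
    (solve 5 (λ π a b g g′ → (a :+ π :* g) :+ (b :+ π :* g′) := (a :+ b) :+ π :* (g :+ g′)) refl π a a′ g g′)
    (+-congʳ k))

  remainder-* : ∀ π f a g f′ a′ g′ {b} → f ≈ a + π * g → f′ ≈ a′ + π * g′ → a * a′ ≈ b →
                f * f′ ≈ b + π * (a * g′ + a′ * g + π * (g * g′))
  remainder-* π f a g f′ a′ g′ h h′ k = trans (*-cong h h′) (trans
    (solve 5 (λ π a b g g′ → (a :+ π :* g) :* (b :+ π :* g′)
      := (a :* b) :+ π :* (a :* g′ :+ b :* g :+ π :* (g :* g′))) refl π a a′ g g′)
    (+-congʳ k))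

  remainder-neg : ∀ π f a g {b} → f ≈ a + π * g → - a ≈ b → - f ≈ b + π * - g
  remainder-neg π f a g h k = trans (-‿cong h) (trans
    (solve 3 (λ π a g → :- (a :+ π :* g) := (:- a) :+ π :* (:- g)) refl π a g)
    (+-congʳ k))

module FiniteSupport (A : CommutativeRing c ℓ) where
  private
    module A = CommutativeRing A
    module S = PowerSeries A
    B = S.commutativeRing
    module B = CommutativeRing B
  open B using (Carrier; _≈_; _+_; _*_; -_; _-_; 0#; 1#)
  open IntegerSolver A using (solve; _:=_; _:+_; _:*_; _:-_; :-_; con)
  open RemainderArithmetic B
  private module SB = IntegerSolver B

  const : A.Carrier → Carrier
  const = constant A.rawRing

  x : Carrier
  x = X A.rawRing

  SupportedBelow : ℕ → Pred Carrier ℓ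
  SupportedBelow N f = ∀ n → N ≤ n → f n A.≈ A.0#

  supported-+ : ∀ {M N f g} → SupportedBelow M f → SupportedBelow N g → SupportedBelow (M ℕ.+ N) (f + g)
  supported-+ {M} {N} h k n le = A.trans
    (A.+-cong (h n (ℕ.m+n≤o⇒m≤o M le)) (k n (ℕ.m+n≤o⇒n≤o M le))) (A.+-identityʳ _)

  supported-neg : ∀ {N f} → SupportedBelow N f → SupportedBelow N (- f)
  supported-neg h n le = A.trans (A.-‿cong (h n le)) (solve 0 (:- con (+ 0) := con (+ 0)) A.refl)

  supported-const : ∀ a → SupportedBelow 1 (const a)
  supported-const a (suc n) _ = A.refl

  supported-x : SupportedBelow 2 x
  supported-x (suc (suc n)) _ = A.refl
  supported-x (suc zero) (s≤s ())

  supported-* : ∀ M {N f g} → SupportedBelow M f → SupportedBelow N g → SupportedBelow (M ℕ.+ N) (f * g)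
  supported-* zero {f = f} {g} h k n le = A.trans (B.*-congʳ {g} {f} {0#} (λ m → h m z≤n) n) (B.zeroˡ g n)
  supported-* (suc M) {f = f} {g} h k (suc n) (s≤s le) = A.trans
    (A.+-cong (A.trans (A.*-congˡ (k (suc n) (ℕ.m≤n⇒m≤1+n (ℕ.m+n≤o⇒n≤o M le)))) (A.zeroʳ _))
              (supported-* M {f = f ∘ suc} {g} (λ m le′ → h (suc m) (s≤s le′)) k n le))
    (A.+-identityʳ _)

  1-x : Carrier
  1-x = 1# - x

  supported-1-x : SupportedBelow 3 1-x
  supported-1-x = supported-+ {1} {f = 1#} (λ { (suc _) _ → A.refl }) (supported-neg {f = x} supported-x)

  private
    1-x-* : ∀ g → 1-x * g ≈ g - x * g
    1-x-* = SB.solve 2 (λ x g → (SB.con (+ 1) SB.:- x) SB.:* g SB.:= g SB.:- x SB.:* g) B.refl x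

  1-x-*-zero : ∀ g → (1-x * g) 0 A.≈ g 0
  1-x-*-zero g = A.trans (1-x-* g 0) (A.trans (A.+-congˡ (A.-‿cong (S.X-*-zero g)))
    (solve 1 (λ a → a :- con (+ 0) := a) A.refl _))

  1-x-*-suc : ∀ g n → (1-x * g) (suc n) A.≈ g (suc n) A.- g n
  1-x-*-suc g n = A.trans (1-x-* g (suc n)) (A.+-congˡ (A.-‿cong (S.X-*-suc g n)))

  1-x-cancel : ∀ g → 1-x * g ≈ 0# → g ≈ 0#
  1-x-cancel g h zero    = A.trans (A.sym (1-x-*-zero g)) (h 0)
  1-x-cancel g h (suc n) = A.trans (solve 2 (λ a b → a := (a :- b) :+ b) A.refl _ (g n))
    (A.trans (A.+-cong (A.trans (A.sym (1-x-*-suc g n)) (h (suc n))) (1-x-cancel g h n)) (A.+-identityʳ _))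

  -- Division by 1 - x; the quotient of f has finite support iff f(1) = 0.
  partialSum : Carrier → Carrier
  partialSum f zero    = f 0
  partialSum f (suc n) = partialSum f n A.+ f (suc n)

  partialSum-* : ∀ f → 1-x * partialSum f ≈ f
  partialSum-* f zero    = 1-x-*-zero (partialSum f)
  partialSum-* f (suc n) = A.trans (1-x-*-suc (partialSum f) n)
    (solve 2 (λ a b → a :+ b :- a := b) A.refl _ _)

  partialSum-const : ∀ {N f} → SupportedBelow (suc N) f → ∀ n → N ≤ n → partialSum f n A.≈ partialSum f N
  partialSum-const {zero} h zero le = A.refl
  partialSum-const {N} h n le with ℕ.m≤n⇒m<n∨m≡n le
  ... | inj₂ ≡.refl = A.refl
  ... | inj₁ (s≤s le′) = A.trans (A.+-cong (partialSum-const h _ le′) (h _ (s≤s le′))) (A.+-identityʳ _)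

  -- f is a polynomial with f(1) = a.
  infix 4 _⇝_
  _⇝_ : Carrier → A.Carrier → Set _
  f ⇝ a = ∃[ g ] (∃[ N ] SupportedBelow N g) × f ≈ const a + 1-x * g

  const-⇝ : ∀ a → const a ⇝ a
  const-⇝ a = 0# , (0 , λ _ _ → A.refl) ,
    SB.solve 2 (λ c p → c SB.:= c SB.:+ p SB.:* SB.con (+ 0)) B.refl (const a) 1-x

  ⇝-resp : ∀ {f f′ a} → f ≈ f′ → f′ ⇝ a → f ⇝ a
  ⇝-resp {f} {f′} {a} f≈f′ (g , s , h) = g , s , B.trans {f} {f′} {const a + 1-x * g} f≈f′ h

  0-⇝ : 0# ⇝ A.0#
  0-⇝ = ⇝-resp {0#} {const A.0#} (λ { zero → A.refl ; (suc _) → A.refl }) (const-⇝ A.0#)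

  1-⇝ : 1# ⇝ A.1#
  1-⇝ = ⇝-resp {1#} {const A.1#} (λ { zero → A.refl ; (suc _) → A.refl }) (const-⇝ A.1#)

  x-⇝ : x ⇝ A.1#
  x-⇝ = - 1# , (1 , supported-neg {1} {1#} λ { (suc _) _ → A.refl }) ,
    B.trans {x} {1# + 1-x * - 1#} {const A.1# + 1-x * - 1#}
     (SB.solve 1 (λ x → x SB.:= SB.con (+ 1) SB.:+ (SB.con (+ 1) SB.:- x) SB.:* (SB.:- SB.con (+ 1))) B.refl x)
     (B.+-congʳ {1-x * - 1#} 1≈const)
    where
    1≈const : 1# ≈ const A.1#
    1≈const zero    = A.refl
    1≈const (suc n) = A.refl

  atOne : Specialisation B A _
  atOne = record
    { _⇝_ = _⇝_
    ; +-⇝ = λ { {f} {f′} {a} {b} (g , (M , s) , h) (g′ , (N , s′) , h′) →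
        g + g′ , (M ℕ.+ N , supported-+ {M} {f = g} s s′) ,
        remainder-+ 1-x f (const a) g f′ (const b) g′ h h′ (const-+ a b) }
    ; *-⇝ = λ { {f} {f′} {a} {b} (g , (M , s) , h) (g′ , (N , s′) , h′) →
        const a * g′ + const b * g + 1-x * (g * g′) ,
        (_ , supported-+ {1 ℕ.+ N ℕ.+ (1 ℕ.+ M)} {f = const a * g′ + const b * g}
               (supported-+ {1 ℕ.+ N} {f = const a * g′} (supported-* 1 {f = const a} (supported-const a) s′)
                 (supported-* 1 {f = const b} (supported-const b) s))
               (supported-* 3 {f = 1-x} supported-1-x (supported-* M {f = g} s s′))) ,
        remainder-* 1-x f (const a) g f′ (const b) g′ h h′ (const-* a b) }
    ; -‿⇝ = λ { {f} {a} (g , (M , s) , h) →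
        - g , (M , supported-neg {f = g} s) , remainder-neg 1-x f (const a) g h (const-neg a) }
    ; zero-⇝ = λ { {f} {a} (g , (N , s) , h) f≈0 → zero-⇝ a g N s (B.trans {0#} {f} {const a + 1-x * g} (B.sym {f} f≈0) h) }
    }
    where
    const-+ : ∀ a b → const a + const b ≈ const (a A.+ b)
    const-+ a b zero    = A.refl
    const-+ a b (suc n) = A.+-identityʳ _
    const-* : ∀ a b → const a * const b ≈ const (a A.* b)
    const-* a b zero    = A.+-identityʳ _
    const-* a b (suc n) = A.trans (S.constant-* a (const b) (suc n)) (A.zeroʳ _)
    const-neg : ∀ a → - const a ≈ const (A.- a)
    const-neg a zero    = A.refl
    const-neg a (suc n) = solve 0 (:- con (+ 0) := con (+ 0)) A.refl
    -- Evaluation at 1 is well defined only because of the finite support: - a / (1 - x) is a series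
    -- with all coefficients equal to - a, and `g` has to be that series, yet its coefficient at `N`
    -- is 0.
    zero-⇝ : ∀ a g N → SupportedBelow N g → 0# ≈ const a + 1-x * g → a A.≈ A.0#
    zero-⇝ a g N s h = A.trans (A.sym (stationary N)) (A.trans (A.-‿cong (s N ℕ.≤-refl)) (solve 0 (:- con (+ 0) := con (+ 0)) A.refl))
      where
      stationary : ∀ n → A.- g n A.≈ a
      stationary zero = A.trans (solve 2 (λ a g → :- g := a :- (a :+ g)) A.refl a (g 0))
        (A.trans (A.+-congˡ (A.-‿cong (A.trans (A.+-congˡ (A.sym (1-x-*-zero g))) (A.sym (h 0)))))
          (solve 1 (λ a → a :- con (+ 0) := a) A.refl a))
      stationary (suc n) = A.trans (solve 2 (λ b g → :- g := :- b :- (con (+ 0) :+ (g :- b))) A.refl (g n) (g (suc n)))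
        (A.trans (A.+-congˡ (A.-‿cong (A.trans (A.+-congˡ (A.sym (1-x-*-suc g n))) (A.sym (h (suc n))))))
          (A.trans (solve 1 (λ a → a :- con (+ 0) := a) A.refl _) (stationary n)))

  module _ (K : Pred A.Carrier κ) (K-+ : ∀ {a b} → K a → K b → K (a A.+ b)) where

    -- The condition `K` on the coefficients makes the construction iterable: it is vacuous over ℚ,
    -- and in the second variable it keeps the coefficients polynomial.
    Bounded : ℕ → Pred Carrier _
    Bounded N f = SupportedBelow N f × (∀ n → K (f n))

    partialSum-K : ∀ {f} → (∀ n → K (f n)) → ∀ n → K (partialSum f n)
    partialSum-K h zero    = h 0
    partialSum-K h (suc n) = K-+ (partialSum-K h n) (h (suc n))

    -- The partial sums are the coefficients of f / (1 - x), and they are constant from index `N`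
    -- on, with value f(1). If that value is 0 they are themselves a quotient whose support bound is
    -- one lower.
    specialise : ∀ {N f} → Bounded (suc N) f → ∃[ a ] K a × f ⇝ a ×
                 (a A.≈ A.0# → ∃[ g ] Bounded N g × f ≈ 1-x * g)
    specialise {N} {f} (s , h) = a , partialSum-K h N ,
      (g , (N , λ n le → A.trans (A.+-congʳ (partialSum-const {N} {f} s n le)) (A.-‿inverseʳ a)) , eq) ,
      λ a≈0 → partialSum f ,
        ((λ n le → A.trans (partialSum-const {N} {f} s n le) a≈0) , partialSum-K h) ,
        B.sym {1-x * partialSum f} {f} (partialSum-* f)
      where
      a = partialSum f N
      -- The constant sequence `a` is a / (1 - x), so subtracting it yields the finitely supported
      -- quotient of f - a.
      g = λ n → partialSum f n A.- a
      eq : f ≈ const a + 1-x * g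
      eq zero = A.sym (A.trans (A.+-congˡ (1-x-*-zero g)) (solve 2 (λ a b → a :+ (b :- a) := b) A.refl a (f 0)))
      eq (suc n) = A.sym (A.trans (A.+-congˡ (1-x-*-suc g n))
        (solve 3 (λ a b c → con (+ 0) :+ (b :+ c :- a :- (b :- a)) := c) A.refl a (partialSum f n) (f (suc n))))

    anisotropic-series : ∀ {p₁ p₂ p₃ q₁ q₂ q₃} → p₁ ⇝ q₁ → p₂ ⇝ q₂ → p₃ ⇝ q₃ →
      CubicNorm.Anisotropic A K (q₁ , q₂ , q₃) →
      CubicNorm.Anisotropic B (λ f → ∃[ N ] Bounded N f) (p₁ , p₂ , p₃)
    anisotropic-series h₁ h₂ h₃ an = CubicNorm.anisotropic λ v₀ v₁ v₂ (N₀ , s₀ , k₀) (N₁ , s₁ , k₁) (N₂ , s₂ , k₂) →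
      CubicNorm.norm-zero (Descent.anisotropic-lift atOne K Bounded 1-x 1-x-cancel (λ s n → proj₁ s n z≤n) specialise
        h₁ h₂ h₃ an (N₀ ℕ.⊔ (N₁ ℕ.⊔ N₂))) v₀ v₁ v₂
        ((λ n le → s₀ n (ℕ.m⊔n≤o⇒m≤o N₀ _ le)) , k₀)
        ((λ n le → s₁ n (ℕ.m⊔n≤o⇒m≤o N₁ _ (ℕ.m⊔n≤o⇒n≤o N₀ _ le))) , k₁)
        ((λ n le → s₂ n (ℕ.m⊔n≤o⇒n≤o N₁ _ (ℕ.m⊔n≤o⇒n≤o N₀ _ le))) , k₂)

-- The norm form modulo 2 and over ℤ

module ModTwo where
  open import Data.Integer.Base using (_+_; _*_; -_; 0ℤ; 1ℤ)
  open import Relation.Binary.PropositionalEquality using (refl; sym; trans)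

  digit : Bool → ℤ
  digit false = 0ℤ
  digit true  = 1ℤ

  infix 4 _⇝_
  _⇝_ : ℤ → Bool → Set
  i ⇝ b = ∃[ j ] i ≡ digit b + + 2 * j

  reduction : Specialisation ℤ.+-*-commutativeRing xor-∧-commutativeRing 0ℓ
  reduction = record
    { _⇝_    = _⇝_
    ; +-⇝    = λ { {a = a} {b} (i , refl) (j , refl) → add a b i j }
    ; *-⇝    = λ { {a = a} {b} (i , refl) (j , refl) → mul a b i j }
    ; -‿⇝    = λ { {a = a} (i , refl) → neg a i }
    ; zero-⇝ = λ { {a = a} (i , refl) → vanish a i }
    }
    where
    add : ∀ a b i j → (digit a + + 2 * i) + (digit b + + 2 * j) ⇝ a xor b
    add false false i j = i + j , lemma i j
      where
      lemma : ∀ i j → (0ℤ + + 2 * i) + (0ℤ + + 2 * j) ≡ 0ℤ + + 2 * (i + j)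
      lemma = solve-∀
    add false true i j = i + j , lemma i j
      where
      lemma : ∀ i j → (0ℤ + + 2 * i) + (1ℤ + + 2 * j) ≡ 1ℤ + + 2 * (i + j)
      lemma = solve-∀
    add true false i j = i + j , lemma i j
      where
      lemma : ∀ i j → (1ℤ + + 2 * i) + (0ℤ + + 2 * j) ≡ 1ℤ + + 2 * (i + j)
      lemma = solve-∀
    add true true i j = 1ℤ + (i + j) , lemma i j
      where
      lemma : ∀ i j → (1ℤ + + 2 * i) + (1ℤ + + 2 * j) ≡ 0ℤ + + 2 * (1ℤ + (i + j))
      lemma = solve-∀

    mul : ∀ a b i j → (digit a + + 2 * i) * (digit b + + 2 * j) ⇝ a ∧ b
    mul false b i j = i * (digit b + + 2 * j) , lemma i (digit b + + 2 * j)
      where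
      lemma : ∀ i k → (0ℤ + + 2 * i) * k ≡ 0ℤ + + 2 * (i * k)
      lemma = solve-∀
    mul true b i j = j + i * (digit b + + 2 * j) , lemma (digit b) i j
      where
      lemma : ∀ d i j → (1ℤ + + 2 * i) * (d + + 2 * j) ≡ d + + 2 * (j + i * (d + + 2 * j))
      lemma = solve-∀

    neg : ∀ a i → - (digit a + + 2 * i) ⇝ a
    neg a i = - (digit a + i) , lemma (digit a) i
      where
      lemma : ∀ d i → - (d + + 2 * i) ≡ d + + 2 * - (d + i)
      lemma = solve-∀

    uncarry : ∀ k → k ≡ (1ℤ + k) + ℤ.-1ℤ
    uncarry = solve-∀

    vanish : ∀ a i → digit a + + 2 * i ≡ 0ℤ → a ≡ false
    vanish false i h = refl
    -- From 1 + 2i = 0 follows 2 ∣i∣ = 1, hence 2 = 1.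
    vanish true  i h with () ← ℕ.m*n≡1⇒m≡1 2 ∣ i ∣ (trans (sym (ℤ.abs-* (+ 2) i))
      (cong ∣_∣ (trans (uncarry (+ 2 * i)) (cong (_+ ℤ.-1ℤ) h))))

  Bounded : ℕ → Pred ℤ 0ℓ
  Bounded n i = ∣ i ∣ ≤ n

  halve : ∀ n j → ∣ + 2 * j ∣ ≤ suc n → ∣ j ∣ ≤ n
  halve n j le = go ∣ j ∣ (ℕ.≤-trans (ℕ.≤-reflexive (sym (ℤ.abs-* (+ 2) j))) le)
    where
    go : ∀ m → 2 ℕ.* m ≤ suc n → m ≤ n
    go zero    _        = z≤n
    go (suc m) (s≤s le) = ℕ.≤-trans (ℕ.≤-reflexive (cong suc (sym (ℕ.+-identityʳ m)))) (ℕ.m+n≤o⇒n≤o m le)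

  specialise : ∀ {n i} → Bounded (suc n) i → ∃[ a ] ⊤ × i ⇝ a ×
               (a ≡ false → ∃[ j ] Bounded n j × i ≡ + 2 * j)
  specialise {n} {i} le with i ℤ.% + 2 | ℤ.n%d<d i (+ 2) | ℤ.a≡a%n+[a/n]*n i (+ 2)
  ... | 0 | _ | e = false , tt , (j , trans i≡2j (sym (ℤ.+-identityˡ _))) ,
    λ _ → j , halve n j (ℕ.≤-trans (ℕ.≤-reflexive (cong ∣_∣ (sym i≡2j))) le) , i≡2j
    where
    j = i ℤ./ + 2
    i≡2j : i ≡ + 2 * j
    i≡2j = trans e (trans (ℤ.+-identityˡ _) (ℤ.*-comm j (+ 2)))
  ... | 1 | _ | e = true , tt , (i ℤ./ + 2 , trans e (cong (_+_ 1ℤ) (ℤ.*-comm (i ℤ./ + 2) (+ 2)))) , λ ()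
  ... | suc (suc _) | s≤s (s≤s ()) | _

  two-cancel : ∀ i → + 2 * i ≡ 0ℤ → i ≡ 0ℤ
  two-cancel i h with inj₂ h′ ← ℤ.i*j≡0⇒i≡0∨j≡0 (+ 2) h = h′

  -- T³ + T + 1 has no root in 𝔽₂.
  anisotropic-𝔽₂ : CubicNorm.Anisotropic xor-∧-commutativeRing (λ _ → ⊤) (true , false , true)
  anisotropic-𝔽₂ = CubicNorm.anisotropic norm-zero
    where
    open CubicNorm xor-∧-commutativeRing hiding (norm-zero)
    norm-zero : ∀ a b c → ⊤ → ⊤ → ⊤ → norm (true , false , true) (a , b , c) ≡ false → Zero (a , b , c)
    norm-zero false false false _ _ _ _ = refl , refl , refl
    norm-zero false false true  _ _ _ ()
    norm-zero false true  false _ _ _ ()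
    norm-zero false true  true  _ _ _ ()
    norm-zero true  false false _ _ _ ()
    norm-zero true  false true  _ _ _ ()
    norm-zero true  true  false _ _ _ ()
    norm-zero true  true  true  _ _ _ ()

  -- The constants are the coefficients of the cubic at x = y = 1. The witnesses 0, 1, 3 are their
  -- quotients by 2, and the sum of the three absolute values is a common starting bound for the
  -- descent.
  anisotropic-ℤ : CubicNorm.Anisotropic ℤ.+-*-commutativeRing (λ _ → ⊤) (+ 1 , + 2 , + 7)
  anisotropic-ℤ = CubicNorm.anisotropic λ i j k _ _ _ → CubicNorm.norm-zero
    (Descent.anisotropic-lift reduction (λ _ → ⊤) Bounded (+ 2) two-cancel (ℤ.∣i∣≡0⇒i≡0 ∘ ℕ.n≤0⇒n≡0) specialise
      (0ℤ , refl) (+ 1 , refl) (+ 3 , refl) anisotropic-𝔽₂ (∣ i ∣ ℕ.+ (∣ j ∣ ℕ.+ ∣ k ∣))) i j k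
      (ℕ.m≤m+n _ _) (ℕ.≤-trans (ℕ.m≤m+n _ _) (ℕ.m≤n+m _ ∣ i ∣))
      (ℕ.≤-trans (ℕ.m≤n+m _ ∣ j ∣) (ℕ.m≤n+m _ ∣ i ∣))

-- From ℤ to ℚ

module Rationals where
  open import Data.Rational.Base using (ℚ; mkℚ; 0ℚ; _+_; _*_; -_)
  open import Relation.Binary.PropositionalEquality using (refl; sym; trans)
  open ModTwo

  ι : ℤ → ℚ
  ι i = i ℚ./ 1

  toℚᵘ-ι : ∀ i → ℚ.toℚᵘ (ι i) ℚᵘ.≃ mkℚᵘ i 0
  toℚᵘ-ι i = ℚ.toℚᵘ-fromℚᵘ (mkℚᵘ i 0)

  ι-+ : ∀ i j → ι (i ℤ.+ j) ≡ ι i + ι j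
  ι-+ i j = ℚ.toℚᵘ-injective (begin
    ℚ.toℚᵘ (ι (i ℤ.+ j))                ≈⟨ toℚᵘ-ι (i ℤ.+ j) ⟩
    mkℚᵘ (i ℤ.+ j) 0                    ≈⟨ *≡* (lemma i j) ⟩
    mkℚᵘ i 0 ℚᵘ.+ mkℚᵘ j 0              ≈⟨ ℚᵘ.+-cong (toℚᵘ-ι i) (toℚᵘ-ι j) ⟨
    ℚ.toℚᵘ (ι i) ℚᵘ.+ ℚ.toℚᵘ (ι j)      ≈⟨ ℚ.toℚᵘ-homo-+ (ι i) (ι j) ⟨
    ℚ.toℚᵘ (ι i + ι j)                  ∎)
    where
    open SetoidReasoning ℚᵘ.≃-setoid
    lemma : ∀ i j → (i ℤ.+ j) ℤ.* + 1 ≡ (i ℤ.* + 1 ℤ.+ j ℤ.* + 1) ℤ.* + 1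
    lemma = solve-∀

  ι-* : ∀ i j → ι (i ℤ.* j) ≡ ι i * ι j
  ι-* i j = ℚ.toℚᵘ-injective (begin
    ℚ.toℚᵘ (ι (i ℤ.* j))                ≈⟨ toℚᵘ-ι (i ℤ.* j) ⟩
    mkℚᵘ (i ℤ.* j) 0                    ≈⟨ *≡* refl ⟩
    mkℚᵘ i 0 ℚᵘ.* mkℚᵘ j 0              ≈⟨ ℚᵘ.*-cong (toℚᵘ-ι i) (toℚᵘ-ι j) ⟨
    ℚ.toℚᵘ (ι i) ℚᵘ.* ℚ.toℚᵘ (ι j)      ≈⟨ ℚ.toℚᵘ-homo-* (ι i) (ι j) ⟨
    ℚ.toℚᵘ (ι i * ι j)                  ∎)
    where open SetoidReasoning ℚᵘ.≃-setoid

  ι-neg : ∀ i → ι (ℤ.- i) ≡ - ι i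
  ι-neg i = ℚ.toℚᵘ-injective (begin
    ℚ.toℚᵘ (ι (ℤ.- i))                  ≈⟨ toℚᵘ-ι (ℤ.- i) ⟩
    ℚᵘ.- mkℚᵘ i 0                       ≈⟨ ℚᵘ.-‿cong (toℚᵘ-ι i) ⟨
    ℚᵘ.- ℚ.toℚᵘ (ι i)                   ≈⟨ ℚ.toℚᵘ-homo‿- (ι i) ⟨
    ℚ.toℚᵘ (- ι i)                      ∎)
    where open SetoidReasoning ℚᵘ.≃-setoid

  ι≡0⇒≡0 : ∀ i → ι i ≡ 0ℚ → i ≡ + 0
  ι≡0⇒≡0 i h with *≡* e ← ℚᵘ.≃-trans (ℚᵘ.≃-sym (toℚᵘ-ι i)) (ℚᵘ.≃-reflexive (cong ℚ.toℚᵘ h)) =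
    trans (sym (ℤ.*-identityʳ i)) e

  integers : Specialisation ℤ.+-*-commutativeRing ℚ.+-*-commutativeRing 0ℓ
  integers = record
    { _⇝_    = λ i x → ι i ≡ x
    ; +-⇝    = λ { {i} {j} refl refl → ι-+ i j }
    ; *-⇝    = λ { {i} {j} refl refl → ι-* i j }
    ; -‿⇝    = λ { {i} refl → ι-neg i }
    ; zero-⇝ = λ { refl refl → refl }
    }

  clearDenominator : ∀ x → ι (ℚ.↥ x) ≡ ι (ℚ.↧ x) * x
  clearDenominator x@(mkℚ n d-1 _) = ℚ.toℚᵘ-injective (begin
    ℚ.toℚᵘ (ι n)                          ≈⟨ toℚᵘ-ι n ⟩
    mkℚᵘ n 0                              ≈⟨ *≡* (lemma n (+ suc d-1)) ⟩
    mkℚᵘ (+ suc d-1) 0 ℚᵘ.* mkℚᵘ n d-1     ≈⟨ ℚᵘ.*-cong (toℚᵘ-ι (+ suc d-1)) (ℚᵘ.≃-refl {mkℚᵘ n d-1}) ⟨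
    ℚ.toℚᵘ (ι (+ suc d-1)) ℚᵘ.* ℚ.toℚᵘ x  ≈⟨ ℚ.toℚᵘ-homo-* (ι (+ suc d-1)) x ⟨
    ℚ.toℚᵘ (ι (+ suc d-1) * x)            ∎)
    where
    open SetoidReasoning ℚᵘ.≃-setoid
    lemma : ∀ n d → n ℤ.* (+ 1 ℤ.* d) ≡ (d ℤ.* n) ℤ.* + 1
    lemma = solve-∀

  open CubicNorm ℚ.+-*-commutativeRing
  open IntegerSolver ℚ.+-*-commutativeRing using (solve; _:=_; _:*_)

  -- Multiplying a triple by the product `D` of its denominators makes it integral and multiplies
  -- its norm by `D` cubed, so a rational zero yields an integral one. Denominators being nonzero,
  -- the vanishing of that integral triple passes back to the numerators.
  anisotropic-ℚ : Anisotropic (λ _ → ⊤) (ι (+ 1) , ι (+ 2) , ι (+ 7))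
  anisotropic-ℚ = anisotropic λ x y z _ _ _ h → clear x y z h
    where
    ↥ = ℚ.↥_
    ↧ = ℚ.↧_
    p = ι (+ 1) , ι (+ 2) , ι (+ 7)
    numeratorι : ∀ x y z → ι (↥ x ℤ.* ↧ y ℤ.* ↧ z) ≡ ι (↧ x) * x * ι (↧ y) * ι (↧ z)
    numeratorι x y z = trans (ι-* (↥ x ℤ.* ↧ y) (↧ z)) (cong (_* ι (↧ z))
      (trans (ι-* (↥ x) (↧ y)) (cong (_* ι (↧ y)) (clearDenominator x))))
    denominator≢0 : ∀ i x → i ℤ.* ↧ x ≡ + 0 → i ≡ + 0
    denominator≢0 i x h with ℤ.i*j≡0⇒i≡0∨j≡0 i h
    ... | inj₁ i≡0 = i≡0
    ... | inj₂ ()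
    numerator : ∀ x y z → ↥ x ℤ.* ↧ y ℤ.* ↧ z ≡ + 0 → x ≡ 0ℚ
    numerator x y z h = ℚ.↥p≡0⇒p≡0 x (denominator≢0 _ y (denominator≢0 _ z h))
    clear : ∀ x y z → norm p (x , y , z) ≡ 0ℚ → Zero (x , y , z)
    clear x y z h =
      let e , f , g = CubicNorm.norm-zero anisotropic-ℤ _ _ _ tt tt tt (ι≡0⇒≡0 _
            (trans (norm-⇝ integers {+ 1} {+ 2} {+ 7} {(↥ x ℤ.* ↧ y) ℤ.* ↧ z} {(↥ y ℤ.* ↧ x) ℤ.* ↧ z} {(↥ z ℤ.* ↧ x) ℤ.* ↧ y} refl refl refl ex ey ez)
            (trans (norm-scale p D (x , y , z))
            (trans (cong (λ w → D * (D * (D * w))) h)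
                   (trans (cong (λ w → D * (D * w)) (ℚ.*-zeroʳ D)) (trans (cong (D *_) (ℚ.*-zeroʳ D)) (ℚ.*-zeroʳ D)))))))
      in numerator x y z e , numerator y x z f , numerator z x y g
      where
      D = ι (↧ x) * (ι (↧ y) * ι (↧ z))
      ex : ι (↥ x ℤ.* ↧ y ℤ.* ↧ z) ≡ D * x
      ex = trans (numeratorι x y z) (solve 4 (λ a b c x → a :* x :* b :* c := a :* (b :* c) :* x) refl (ι (↧ x)) (ι (↧ y)) (ι (↧ z)) x)
      ey : ι (↥ y ℤ.* ↧ x ℤ.* ↧ z) ≡ D * y
      ey = trans (numeratorι y x z) (solve 4 (λ a b c y → b :* y :* a :* c := a :* (b :* c) :* y) refl (ι (↧ x)) (ι (↧ y)) (ι (↧ z)) y)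
      ez : ι (↥ z ℤ.* ↧ x ℤ.* ↧ y) ≡ D * z
      ez = trans (numeratorι z x y) (solve 4 (λ a b c z → c :* z :* a :* b := a :* (b :* c) :* z) refl (ι (↧ x)) (ι (↧ y)) (ι (↧ z)) z)

-- The coefficients of the cubic

module Coefficients (R : RawRing c ℓ) where
  open RingOperations R

  -- Opaque for the same reason as Anisotropic is a record.
  opaque
    coefficient₁ coefficient₂ coefficient₃ : Carrier → Carrier → Carrier
    coefficient₁ x y = x ^ 3 - y ^ 2 + 1#
    coefficient₂ x y = x ^ 3 * y ^ 2 - y ^ 4 + x ^ 3 + 2 · y ^ 2 - 1#
    coefficient₃ x y = y ^ 6 - x ^ 6 + 6 · y ^ 2 * x ^ 3 - 3 · y ^ 4 + 2 · x ^ 3 + 3 · y ^ 2 - 1#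

  coefficients : Carrier → Carrier → Carrier × Carrier × Carrier
  coefficients x y = coefficient₁ x y , coefficient₂ x y , coefficient₃ x y

  record IsRoot (x y θ : Carrier) : Set ℓ where
    constructor isRoot
    field
      equation :
        (y ^ 6 - x ^ 6 + 6 · y ^ 2 * x ^ 3 - 3 · y ^ 4 + 2 · x ^ 3 + 3 · y ^ 2 - 1#) * θ ^ 3
          + (x ^ 3 * y ^ 2 - y ^ 4 + x ^ 3 + 2 · y ^ 2 - 1#) * θ ^ 2
          + (x ^ 3 - y ^ 2 + 1#) * θ
          + 1#
          ≈ 0#

  record IsDiagonalRoot (x θ : Carrier) : Set ℓ where
    constructor isDiagonalRoot
    field
      equation :
        (6 · x ^ 5 - 3 · x ^ 4 + 2 · x ^ 3 + 3 · x ^ 2 - 1#) * θ ^ 3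
          + (x ^ 5 - x ^ 4 + x ^ 3 + 2 · x ^ 2 - 1#) * θ ^ 2
          + (x ^ 3 - x ^ 2 + 1#) * θ
          + 1#
          ≈ 0#

-- Elimination, weights of normal forms, and degree 3

module Equation (R : CommutativeRing c ℓ) where
  open CommutativeRing R hiding (zero)
  open CubicNorm R
  open RingOperations rawRing using (_^_; _·_)
  open Coefficients rawRing
  open IntegerSolver R using (Polynomial; solve; _:=_; _:+_; _:*_; _:-_; :-_; con)
  open SetoidReasoning setoid

  private
    infixr 9 _:^_ _:·_
    -- Unfolds as `_^_` does, and `_:·_` as `_·_`, so that solved identities match the literal form
    -- of the equations definitionally.
    _:^_ : ∀ {n} → Polynomial n → ℕ → Polynomial n
    p :^ zero  = con (+ 1)
    p :^ suc k = p :* p :^ k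
    _:·_ : ∀ {n} → ℕ → Polynomial n → Polynomial n
    zero  :· p = con (+ 0)
    suc k :· p = p :+ k :· p

    :c₁ :c₂ :c₃ :c₁′ :c₂′ :c₃′ : ∀ {n} → Polynomial n → Polynomial n → Polynomial n
    :c₁ x y = x :^ 3 :- y :^ 2 :+ con (+ 1)
    :c₂ x y = x :^ 3 :* y :^ 2 :- y :^ 4 :+ x :^ 3 :+ 2 :· y :^ 2 :- con (+ 1)
    :c₃ x y = y :^ 6 :- x :^ 6 :+ 6 :· y :^ 2 :* x :^ 3 :- 3 :· y :^ 4 :+ 2 :· x :^ 3 :+ 3 :· y :^ 2 :- con (+ 1)
    :c₁′ a b = a :- b :+ con (+ 1)
    :c₂′ a b = a :* b :- b :* b :+ a :+ (b :+ b) :- con (+ 1)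
    :c₃′ a b = b :* (b :* b) :- a :* a :+ con (+ 6) :* (b :* a) :- con (+ 3) :* (b :* b)
                 :+ con (+ 2) :* a :+ con (+ 3) :* b :- con (+ 1)

    :cubic : ∀ {n} → Polynomial n → Polynomial n → Polynomial n → Polynomial n → Polynomial n
    :cubic p₁ p₂ p₃ θ = p₃ :* (θ :* (θ :* θ)) :+ p₂ :* (θ :* θ) :+ p₁ :* θ :+ con (+ 1)

  opaque
    unfolding coefficient₁ coefficient₂ coefficient₃

    cubic⇒isRoot : ∀ {x y θ} → cubic (coefficients x y) θ ≈ 0# → IsRoot x y θ
    cubic⇒isRoot {x} {y} {θ} h = isRoot (trans
      (solve 4 (λ p₁ p₂ p₃ θ → p₃ :* θ :^ 3 :+ p₂ :* θ :^ 2 :+ p₁ :* θ :+ con (+ 1)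
        := :cubic p₁ p₂ p₃ θ) refl
        (coefficient₁ x y) (coefficient₂ x y) (coefficient₃ x y) θ) h)

    cubic⇒isDiagonalRoot : ∀ {x θ} → cubic (coefficients x x) θ ≈ 0# → IsDiagonalRoot x θ
    cubic⇒isDiagonalRoot {x} {θ} h = isDiagonalRoot (trans
      (solve 2 (λ x θ →
        (6 :· x :^ 5 :- 3 :· x :^ 4 :+ 2 :· x :^ 3 :+ 3 :· x :^ 2 :- con (+ 1)) :* θ :^ 3
          :+ (x :^ 5 :- x :^ 4 :+ x :^ 3 :+ 2 :· x :^ 2 :- con (+ 1)) :* θ :^ 2
          :+ (x :^ 3 :- x :^ 2 :+ con (+ 1)) :* θ
          :+ con (+ 1)
        := :cubic (:c₁ x x) (:c₂ x x) (:c₃ x x) θ) refl x θ) h)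

  private
    -- The coefficients in terms of a = x³ and b = y².
    c₁′ c₂′ c₃′ : Carrier → Carrier → Carrier
    c₁′ a b = a - b + 1#
    c₂′ a b = a * b - b * b + a + (b + b) - 1#
    c₃′ a b = b * (b * b) - a * a + ⟨6⟩ * (b * a) - ⟨3⟩ * (b * b) + ⟨2⟩ * a + ⟨3⟩ * b - 1#
      where
      -- Nested to the left like the numerals of `fromℤ`, so that `con (+ 6)` in `:c₃′` denotes
      -- `⟨6⟩` definitionally.
      ⟨2⟩ = 1# + 1#
      ⟨3⟩ = ⟨2⟩ + 1#
      ⟨6⟩ = ⟨3⟩ + 1# + 1# + 1#

    -- That only x³ and y² occur reflects the abelianisation ℤ/3 × ℤ/2 of Γ: in a trivial word the
    -- number of U is divisible by 3 and the number of S is even.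
    cubic′ : Carrier → Carrier → Carrier → Carrier
    cubic′ a b θ = cubic (c₁′ a b , c₂′ a b , c₃′ a b) θ

    cubic′-cong : ∀ {a a′ b b′} θ → a ≈ a′ → b ≈ b′ → cubic′ a b θ ≈ cubic′ a′ b′ θ
    cubic′-cong θ h k = +-congʳ (+-cong (+-cong
      (*-congʳ (+-congʳ (+-cong (+-cong (+-cong (+-cong (+-cong
        (*-cong k (*-cong k k)) (-‿cong (*-cong h h))) (*-congˡ (*-cong k h)))
        (-‿cong (*-congˡ (*-cong k k)))) (*-congˡ h)) (*-congˡ k))))
      (*-congʳ (+-congʳ (+-cong (+-cong (+-cong (*-cong h k) (-‿cong (*-cong k k))) h) (+-cong k k)))))
      (*-congʳ (+-congʳ (+-cong h (-‿cong k)))))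

    opaque
      unfolding coefficient₁ coefficient₂ coefficient₃

      cubic-cubic′ : ∀ x y θ → cubic (coefficients x y) θ ≈ cubic′ (x * (x * x)) (y * y) θ
      cubic-cubic′ = solve 3 (λ x y θ → :cubic (:c₁ x y) (:c₂ x y) (:c₃ x y) θ :=
        :cubic (:c₁′ (x :* (x :* x)) (y :* y)) (:c₂′ (x :* (x :* x)) (y :* y)) (:c₃′ (x :* (x :* x)) (y :* y)) θ) refl

    -- On the curve a = (1 - w)² v, b = w (1 - v) the cubic has the root 1 / (1 - v - w).
    factor : ∀ v w θ → cubic′ ((1# - w) * ((1# - w) * v)) (w * (1# - v)) θ ≈
      (1# - θ * (1# - v - w)) *
      (c₂′ ((1# - w) * ((1# - w) * v)) (w * (1# - v)) * (θ * θ)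
        + c₁′ ((1# - w) * ((1# - w) * v)) (w * (1# - v)) * θ * (1# + θ * (1# - v - w))
        + (1# + θ * (1# - v - w) + θ * (1# - v - w) * (θ * (1# - v - w))))
    factor = solve 3 (λ v w θ →
      let one = con (+ 1)
          a   = (one :- w) :* ((one :- w) :* v)
          b   = w :* (one :- v)
          t   = θ :* (one :- v :- w)
      in :cubic (:c₁′ a b) (:c₂′ a b) (:c₃′ a b) θ :=
        (one :- t) :* (:c₂′ a b :* (θ :* θ) :+ :c₁′ a b :* θ :* (one :+ t) :+ (one :+ t :+ t :* t))) refl

  module System (x y s α β g : Carrier)
    (s-eq : s ≈ y + x * (β * s))
    (α-eq : α ≈ x + y * (s * α))
    (β-eq : β ≈ x * α + y * (s * β))
    (g-eq : g ≈ 1# + (x * (β * g) + y * (s * g)))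
    where

    -- The system gives (1 - w)² v = x³, w (1 - v) = y² and g (1 - v - w) = 1.
    private
      -- In terms of walks, `v` and `w` generate the loops at 1 that return only at their end, the
      -- last step being U or S respectively; `g` is the geometric series in v + w.
      v = x * β
      w = y * s

      x³-eq : x * (x * x) ≈ (1# - w) * ((1# - w) * v)
      x³-eq = sym (begin
        (1# - w) * ((1# - w) * v)
          ≈⟨ solve 4 (λ x β y s → (con (+ 1) :- y :* s) :* ((con (+ 1) :- y :* s) :* (x :* β))
              := (con (+ 1) :- y :* s) :* (x :* (β :- y :* (s :* β)))) refl x β y s ⟩
        (1# - w) * (x * (β - y * (s * β)))
          ≈⟨ *-congˡ (*-congˡ (+-congʳ β-eq)) ⟩
        (1# - w) * (x * (x * α + y * (s * β) - y * (s * β)))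
          ≈⟨ solve 5 (λ x α β y s → (con (+ 1) :- y :* s) :* (x :* (x :* α :+ y :* (s :* β) :- y :* (s :* β)))
              := x :* (x :* (α :- y :* (s :* α)))) refl x α β y s ⟩
        x * (x * (α - y * (s * α)))
          ≈⟨ *-congˡ (*-congˡ (+-congʳ α-eq)) ⟩
        x * (x * (x + y * (s * α) - y * (s * α)))
          ≈⟨ solve 2 (λ x z → x :* (x :* (x :+ z :- z)) := x :* (x :* x)) refl x _ ⟩
        x * (x * x) ∎)

      y²-eq : y * y ≈ w * (1# - v)
      y²-eq = sym (begin
        w * (1# - v)
          ≈⟨ solve 4 (λ x β y s → y :* s :* (con (+ 1) :- x :* β) := y :* (s :- x :* (β :* s))) refl x β y s ⟩
        y * (s - x * (β * s))
          ≈⟨ *-congˡ (+-congʳ s-eq) ⟩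
        y * (y + x * (β * s) - x * (β * s))
          ≈⟨ solve 2 (λ y z → y :* (y :+ z :- z) := y :* y) refl y _ ⟩
        y * y ∎)

      g-inverse : 1# - g * (1# - v - w) ≈ 0#
      g-inverse = begin
        1# - g * (1# - v - w)
          ≈⟨ solve 5 (λ g x β y s → con (+ 1) :- g :* (con (+ 1) :- x :* β :- y :* s)
              := con (+ 1) :+ (x :* (β :* g) :+ y :* (s :* g)) :- g) refl g x β y s ⟩
        1# + (x * (β * g) + y * (s * g)) - g
          ≈⟨ +-congʳ g-eq ⟨
        g - g
          ≈⟨ -‿inverseʳ g ⟩
        0# ∎

    cubic-root : cubic (coefficients x y) g ≈ 0#
    cubic-root = begin
      cubic (coefficients x y) g        ≈⟨ cubic-cubic′ x y g ⟩
      cubic′ (x * (x * x)) (y * y) g    ≈⟨ cubic′-cong g x³-eq y²-eq ⟩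
      cubic′ ((1# - w) * ((1# - w) * v)) (w * (1# - v)) g ≈⟨ factor v w g ⟩
      _                                 ≈⟨ *-congʳ g-inverse ⟩
      0# * _                            ≈⟨ zeroˡ _ ⟩
      0#                                ∎

    exponentWeight : Exponent → Carrier
    exponentWeight e0 = 1#
    exponentWeight e1 = α
    exponentWeight e2 = β

    tailWeight : Tail → Carrier
    tailWeight one     = 1#
    tailWeight lone-S  = s
    tailWeight (su a)  = s * α * tailWeight a
    tailWeight (su² a) = s * β * tailWeight a

    weight : NF → Carrier
    weight (i , a) = g * (exponentWeight i * tailWeight a)

    δ : NF → Carrier
    δ (e0 , one) = 1#
    δ _          = 0#

    private
      weight-s : ∀ γ τ → g * (1# * (s * γ * τ)) ≈ 0# + (x * (g * (β * (s * γ * τ))) + y * (g * (γ * τ)))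
      weight-s γ τ = begin
        g * (1# * (s * γ * τ))                ≈⟨ *-congˡ (*-congˡ (*-congʳ (*-congʳ s-eq))) ⟩
        g * (1# * ((y + x * (β * s)) * γ * τ))
          ≈⟨ solve 7 (λ g y x β s γ τ → g :* (con (+ 1) :* ((y :+ x :* (β :* s)) :* γ :* τ)) :=
            con (+ 0) :+ (x :* (g :* (β :* (s :* γ :* τ))) :+ y :* (g :* (γ :* τ)))) refl g y x β s γ τ ⟩
        0# + (x * (g * (β * (s * γ * τ))) + y * (g * (γ * τ))) ∎

    -- Each clause is the equation of the leading syllable (`s-eq`, `α-eq` or `β-eq`), multiplied by
    -- `g` and the weight of the remaining syllables; the empty normal form uses `g-eq`.
    weight-step : ∀ n → weight n ≈ δ n + (x * weight (actU (actU n)) + y * weight (actS n))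
    weight-step (e0 , one) = begin
      g * (1# * 1#)                           ≈⟨ *-congʳ g-eq ⟩
      (1# + (x * (β * g) + y * (s * g))) * (1# * 1#)
        ≈⟨ solve 5 (λ x β y s g →
          (con (+ 1) :+ (x :* (β :* g) :+ y :* (s :* g))) :* (con (+ 1) :* con (+ 1)) :=
          con (+ 1) :+ (x :* (g :* (β :* con (+ 1))) :+ y :* (g :* (con (+ 1) :* s)))) refl x β y s g ⟩
      1# + (x * (g * (β * 1#)) + y * (g * (1# * s))) ∎
    weight-step (e0 , lone-S) = begin
      g * (1# * s)                            ≈⟨ *-congˡ (*-congˡ s-eq) ⟩
      g * (1# * (y + x * (β * s)))
        ≈⟨ solve 5 (λ x β y s g → g :* (con (+ 1) :* (y :+ x :* (β :* s))) :=
          con (+ 0) :+ (x :* (g :* (β :* s)) :+ y :* (g :* (con (+ 1) :* con (+ 1))))) refl x β y s g ⟩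
      0# + (x * (g * (β * s)) + y * (g * (1# * 1#))) ∎
    weight-step (e0 , su a)  = weight-s α (tailWeight a)
    weight-step (e0 , su² a) = weight-s β (tailWeight a)
    weight-step (e1 , a) = begin
      g * (α * τ)                             ≈⟨ *-congˡ (*-congʳ α-eq) ⟩
      g * ((x + y * (s * α)) * τ)
        ≈⟨ solve 6 (λ g x y s α τ → g :* ((x :+ y :* (s :* α)) :* τ) :=
          con (+ 0) :+ (x :* (g :* (con (+ 1) :* τ)) :+ y :* (g :* (con (+ 1) :* (s :* α :* τ))))) refl g x y s α τ ⟩
      0# + (x * (g * (1# * τ)) + y * (g * (1# * (s * α * τ)))) ∎
      where τ = tailWeight a
    weight-step (e2 , a) = begin
      g * (β * τ)                             ≈⟨ *-congˡ (*-congʳ β-eq) ⟩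
      g * ((x * α + y * (s * β)) * τ)
        ≈⟨ solve 7 (λ g x y s α β τ → g :* ((x :* α :+ y :* (s :* β)) :* τ) :=
          con (+ 0) :+ (x :* (g :* (α :* τ)) :+ y :* (g :* (con (+ 1) :* (s :* β :* τ))))) refl g x y s α β τ ⟩
      0# + (x * (g * (α * τ)) + y * (g * (1# * (s * β * τ)))) ∎
      where τ = tailWeight a

  module _ (K : Pred Carrier κ) (K-0 : K 0#) (K-1 : K 1#)
    (K-+ : ∀ f g → K f → K g → K (f + g)) (K-* : ∀ f g → K f → K g → K (f * g)) (K-neg : ∀ f → K f → K (- f))
    where

    private
      K-^ : ∀ x n → K x → K (x ^ n)
      K-^ x zero    h = K-1
      K-^ x (suc n) h = K-* _ _ h (K-^ x n h)

      K-· : ∀ n x → K x → K (n · x)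
      K-· zero    x h = K-0
      K-· (suc n) x h = K-+ _ _ h (K-· n x h)

      K-- : ∀ f g → K f → K g → K (f - g)
      K-- f g h k = K-+ _ _ h (K-neg _ k)

    opaque
      unfolding coefficient₁ coefficient₂ coefficient₃

      coefficients-K : ∀ x y → K x → K y → K (coefficient₁ x y) × K (coefficient₂ x y) × K (coefficient₃ x y)
      coefficients-K x y h k =
        K-+ _ _ (K-- _ _ (x^ 3) (y^ 2)) K-1 ,
        K-- _ _ (K-+ _ _ (K-+ _ _ (K-- _ _ (K-* _ _ (x^ 3) (y^ 2)) (y^ 4)) (x^ 3)) (K-· 2 _ (y^ 2))) K-1 ,
        K-- _ _ (K-+ _ _ (K-+ _ _ (K-- _ _ (K-+ _ _ (K-- _ _ (y^ 6) (x^ 6)) (K-* _ _ (K-· 6 _ (y^ 2)) (x^ 3)))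
          (K-· 3 _ (y^ 4))) (K-· 2 _ (x^ 3))) (K-· 3 _ (y^ 2))) K-1
        where
        x^ : ∀ n → K (x ^ n)
        x^ n = K-^ x n h
        y^ : ∀ n → K (y ^ n)
        y^ n = K-^ y n k

  module _ (K : Pred Carrier κ) (K-0 : K 0#) (K-1 : K 1#) where

    -- By `norm-root` a relation of degree at most 2 is a zero of the norm, so anisotropy gives the
    -- independence of 1, θ, θ² over `K`. Relations of lower degree are padded with zeros.
    algebraicOfDegree3 : ∀ p θ → K (proj₁ p) → K (proj₁ (proj₂ p)) → K (proj₂ (proj₂ p)) →
      ¬ proj₂ (proj₂ p) ≈ 0# → cubic p θ ≈ 0# → Anisotropic K p → IsAlgebraicOfDegree rawRing K 3 θ
    algebraicOfDegree3 p@(p₁ , p₂ , p₃) θ k₁ k₂ k₃ p₃≉0 root an = record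
      { P         = P
      ; P-in-K    = λ { zero → K-1 ; (suc zero) → k₁ ; (suc (suc zero)) → k₂ ; (suc (suc (suc zero))) → k₃ }
      ; P-leading = p₃≉0
      ; P-root    = trans
          (solve 4 (λ p₁ p₂ p₃ θ → con (+ 1) :* con (+ 1) :+ (p₁ :* θ :^ 1 :+ (p₂ :* θ :^ 2 :+ (p₃ :* θ :^ 3 :+ con (+ 0))))
            := :cubic p₁ p₂ p₃ θ) refl p₁ p₂ p₃ θ) root
      ; minimal   = minimal
      }
      where
      P : Vector Carrier 4
      P zero = 1#
      P (suc zero) = p₁
      P (suc (suc zero)) = p₂
      P (suc (suc (suc zero))) = p₃

      independent : ∀ v₀ v₁ v₂ → K v₀ → K v₁ → K v₂ → value θ (v₀ , v₁ , v₂) ≈ 0# → Zero (v₀ , v₁ , v₂)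
      independent v₀ v₁ v₂ k₀ k₁ k₂ h = norm-zero an v₀ v₁ v₂ k₀ k₁ k₂ (norm-root p (v₀ , v₁ , v₂) θ root h)

      minimal : ∀ {e} → e < 3 → (V : Vector Carrier (suc e)) → (∀ i → K (V i)) →
        evaluate rawRing K V θ ≈ 0# → ∀ i → V i ≈ 0#
      minimal {0} _ V k h =
        let z , _ , _ = independent (V zero) 0# 0# (k zero) K-0 K-0 (trans
              (solve 2 (λ a θ → a :+ con (+ 0) :* θ :+ con (+ 0) :* (θ :* θ) := a :* con (+ 1) :+ con (+ 0)) refl _ θ) h)
        in λ { zero → z }
      minimal {1} _ V k h =
        let z , z′ , _ = independent (V zero) (V (suc zero)) 0# (k zero) (k (suc zero)) K-0 (trans
              (solve 3 (λ a b θ → a :+ b :* θ :+ con (+ 0) :* (θ :* θ) := a :* con (+ 1) :+ (b :* θ :^ 1 :+ con (+ 0))) refl _ _ θ) h)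
        in λ { zero → z ; (suc zero) → z′ }
      minimal {2} _ V k h =
        let z , z′ , z″ = independent (V zero) (V (suc zero)) (V (suc (suc zero))) (k zero) (k (suc zero)) (k (suc (suc zero))) (trans
              (solve 4 (λ a b c θ → a :+ b :* θ :+ c :* (θ :* θ) := a :* con (+ 1) :+ (b :* θ :^ 1 :+ (c :* θ :^ 2 :+ con (+ 0)))) refl _ _ _ θ) h)
        in λ { zero → z ; (suc zero) → z′ ; (suc (suc zero)) → z″ }
      minimal {suc (suc (suc _))} (s≤s (s≤s (s≤s ())))

module _ {B : CommutativeRing c ℓ} {A : CommutativeRing c′ ℓ′} (S : Specialisation B A r) where
  private
    module B where
      open CommutativeRing B public
      open RingOperations rawRing public using (_^_; _·_)
      open Coefficients rawRing public
      open CubicNorm B public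
    module A where
      open CommutativeRing A public
      open RingOperations rawRing public using (_^_; _·_)
      open Coefficients rawRing public
      open CubicNorm A public
  open Specialisation S

  cubic-⇝ : ∀ {p₁ p₂ p₃ θ q₁ q₂ q₃ φ} → B.1# ⇝ A.1# → p₁ ⇝ q₁ → p₂ ⇝ q₂ → p₃ ⇝ q₃ → θ ⇝ φ →
    B.cubic (p₁ , p₂ , p₃) θ ⇝ A.cubic (q₁ , q₂ , q₃) φ
  cubic-⇝ o h₁ h₂ h₃ k = +-⇝ (+-⇝ (+-⇝ (*-⇝ h₃ (*-⇝ k (*-⇝ k k))) (*-⇝ h₂ (*-⇝ k k))) (*-⇝ h₁ k)) o

  module _ {x y x′ y′} (z : B.0# ⇝ A.0#) (o : B.1# ⇝ A.1#) (hx : x ⇝ x′) (hy : y ⇝ y′) where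

    private
      ^-⇝ : ∀ {f a} n → f ⇝ a → f B.^ n ⇝ a A.^ n
      ^-⇝ zero    h = o
      ^-⇝ (suc n) h = *-⇝ h (^-⇝ n h)

      ·-⇝ : ∀ {f a} n → f ⇝ a → n B.· f ⇝ n A.· a
      ·-⇝ zero    h = z
      ·-⇝ (suc n) h = +-⇝ h (·-⇝ n h)

      x^ : ∀ n → x B.^ n ⇝ x′ A.^ n
      x^ n = ^-⇝ n hx
      y^ : ∀ n → y B.^ n ⇝ y′ A.^ n
      y^ n = ^-⇝ n hy

    opaque
      unfolding Coefficients.coefficient₁ Coefficients.coefficient₂ Coefficients.coefficient₃

      coefficient₁-⇝ : B.coefficient₁ x y ⇝ A.coefficient₁ x′ y′
      coefficient₁-⇝ = +-⇝ (minus-⇝ (x^ 3) (y^ 2)) o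

      coefficient₂-⇝ : B.coefficient₂ x y ⇝ A.coefficient₂ x′ y′
      coefficient₂-⇝ = minus-⇝ (+-⇝ (+-⇝ (minus-⇝ (*-⇝ (x^ 3) (y^ 2)) (y^ 4)) (x^ 3)) (·-⇝ 2 (y^ 2))) o

      coefficient₃-⇝ : B.coefficient₃ x y ⇝ A.coefficient₃ x′ y′
      coefficient₃-⇝ = minus-⇝ (+-⇝ (+-⇝ (minus-⇝ (+-⇝ (minus-⇝ (y^ 6) (x^ 6)) (*-⇝ (·-⇝ 6 (y^ 2)) (x^ 3)))
        (·-⇝ 3 (y^ 4))) (·-⇝ 2 (x^ 3))) (·-⇝ 3 (y^ 2))) o

ℚ-ring ℚ[[x]]-ring ℚ[[x,y]]-ring : CommutativeRing 0ℓ 0ℓ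
ℚ-ring        = ℚ.+-*-commutativeRing
ℚ[[x]]-ring   = PowerSeries.commutativeRing ℚ-ring
ℚ[[x,y]]-ring = PowerSeries.commutativeRing ℚ[[x]]-ring

-- Walk series as fixed points

module WalkSystem where
  open Bivariate using (Carrier; _≈_; _+_; _*_; 0#; 1#; x; y)
  open import Relation.Binary.PropositionalEquality using (refl; sym; trans)
  private
    module Y = PowerSeries ℚ-ring
    module S = PowerSeries ℚ[[x]]-ring
    module R = CommutativeRing ℚ[[x,y]]-ring

  x-*-zero : ∀ f m → (x * f) 0 m ≡ ℚ.0ℚ
  x-*-zero f = S.X-*-zero f

  x-*-suc : ∀ f n m → (x * f) (suc n) m ≡ f n m
  x-*-suc f = S.X-*-suc f

  y-*-zero : ∀ f n → (y * f) n 0 ≡ ℚ.0ℚ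
  y-*-zero f n = trans (S.constant-* (X ℚ.+-*-rawRing) f n 0) (Y.X-*-zero (f n))

  y-*-suc : ∀ f n m → (y * f) n (suc m) ≡ f n m
  y-*-suc f n m = trans (S.constant-* (X ℚ.+-*-rawRing) f n (suc m)) (Y.X-*-suc (f n) m)

  *-local : ∀ n m {f f′ g g′ : Carrier} → (∀ i j → i ≤ n → j ≤ m → f i j ≡ f′ i j) →
    (∀ i j → i ≤ n → j ≤ m → g i j ≡ g′ i j) → (f * g) n m ≡ (f′ * g′) n m
  *-local zero    m h k = cong (ℚ._+ ℚ.0ℚ) (Y.*-local m (λ j → h 0 j z≤n) (λ j → k 0 j z≤n))
  *-local (suc n) m h k = cong₂ ℚ._+_ (Y.*-local m (λ j → h 0 j z≤n) (λ j → k (suc n) j ℕ.≤-refl))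
    (*-local n m (λ i j le → h (suc i) j (s≤s le)) (λ i j le → k i j (ℕ.m≤n⇒m≤1+n le)))

  -- Agreement up to terms of total degree at least k.
  infix 4 _≈[_]_
  _≈[_]_ : Carrier → ℕ → Carrier → Set
  f ≈[ k ] g = ∀ n m → n ℕ.+ m < k → f n m ≡ g n m

  ≈⇒≈[] : ∀ {k f g} → f ≈ g → f ≈[ k ] g
  ≈⇒≈[] h n m _ = h n m

  ≈[]-trans : ∀ {k f g h} → f ≈[ k ] g → g ≈[ k ] h → f ≈[ k ] h
  ≈[]-trans p q n m lt = trans (p n m lt) (q n m lt)

  ≈[]-sym : ∀ {k f g} → f ≈[ k ] g → g ≈[ k ] f
  ≈[]-sym p n m lt = sym (p n m lt)

  +-cong[] : ∀ {k f f′ g g′} → f ≈[ k ] f′ → g ≈[ k ] g′ → f + g ≈[ k ] f′ + g′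
  +-cong[] h k n m lt = cong₂ ℚ._+_ (h n m lt) (k n m lt)

  *-cong[] : ∀ {k} f f′ g g′ → f ≈[ k ] f′ → g ≈[ k ] g′ → f * g ≈[ k ] f′ * g′
  *-cong[] f f′ g g′ h k n m lt = *-local n m {f} {f′} {g} {g′}
    (λ i j p q → h i j (ℕ.≤-<-trans (ℕ.+-mono-≤ p q) lt))
    (λ i j p q → k i j (ℕ.≤-<-trans (ℕ.+-mono-≤ p q) lt))

  x-cong[] : ∀ {k} f g → f ≈[ k ] g → x * f ≈[ suc k ] x * g
  x-cong[] f g h zero    m _        = trans (x-*-zero f m) (sym (x-*-zero g m))
  x-cong[] f g h (suc n) m (s≤s lt) = trans (x-*-suc f n m) (trans (h n m lt) (sym (x-*-suc g n m)))

  y-cong[] : ∀ {k} f g → f ≈[ k ] g → y * f ≈[ suc k ] y * g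
  y-cong[] f g h n zero    _  = trans (y-*-zero f n) (sym (y-*-zero g n))
  y-cong[] f g h n (suc m) lt = trans (y-*-suc f n m) (trans
    (h n m (ℕ.s≤s⁻¹ (ℕ.≤-trans (ℕ.≤-reflexive (cong suc (sym (ℕ.+-suc n m)))) lt))) (sym (y-*-suc g n m)))

  -- A contraction for the ultrametric of total degree, uniformly in the index; the existence and
  -- uniqueness below are Banach's fixed point theorem for it.
  Contractive : {I : Set} → ((I → Carrier) → (I → Carrier)) → Set
  Contractive Φ = ∀ {k F G} → (∀ i → F i ≈[ k ] G i) → ∀ i → Φ F i ≈[ suc k ] Φ G i

  module _ {I : Set} (Φ : (I → Carrier) → (I → Carrier)) (contractive : Contractive Φ) where

    fixedPoint-unique : ∀ {F G} → (∀ i → F i ≈ Φ F i) → (∀ i → G i ≈ Φ G i) → ∀ i → F i ≈ G i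
    fixedPoint-unique {F} {G} h k i n m = agree (suc (n ℕ.+ m)) i n m ℕ.≤-refl
      where
      agree : ∀ k i → F i ≈[ k ] G i
      agree zero    i n m ()
      agree (suc l) i = ≈[]-trans {f = F i} (≈⇒≈[] {f = F i} (h i))
        (≈[]-trans {f = Φ F i} (contractive (agree l) i) (≈[]-sym {f = G i} (≈⇒≈[] {f = G i} (k i))))

    iterate : ℕ → I → Carrier
    iterate zero    _ = 0#
    iterate (suc k)   = Φ (iterate k)

    iterate-step : ∀ k i → iterate k i ≈[ k ] iterate (suc k) i
    iterate-step zero    i n m ()
    iterate-step (suc k) i = contractive (iterate-step k) i

    iterate-stable : ∀ d {k} i → iterate k i ≈[ k ] iterate (d ℕ.+ k) i
    iterate-stable zero        i n m lt = refl
    iterate-stable (suc d) {k} i n m lt = trans (iterate-stable d i n m lt)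
      (iterate-step (d ℕ.+ k) i n m (ℕ.≤-trans lt (ℕ.m≤n+m k d)))

    -- Iterate k is final in total degrees below k, so the coefficient of degree n + m is taken from
    -- iterate `suc (n ℕ.+ m)`.
    fixedPoint : I → Carrier
    fixedPoint i n m = iterate (suc (n ℕ.+ m)) i n m

    fixedPoint-≈[] : ∀ k i → fixedPoint i ≈[ k ] iterate k i
    fixedPoint-≈[] k i n m lt = trans (iterate-stable (k ∸ suc (n ℕ.+ m)) i n m ℕ.≤-refl)
      (cong (λ l → iterate l i n m) (ℕ.m∸n+n≡m lt))

    fixedPoint-fixed : ∀ i → fixedPoint i ≈ Φ fixedPoint i
    fixedPoint-fixed i n m = ≈[]-trans {f = fixedPoint i} (fixedPoint-≈[] (suc k) i)
      (≈[]-sym {f = Φ fixedPoint i} (contractive (fixedPoint-≈[] k) i)) n m ℕ.≤-refl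
      where k = n ℕ.+ m

  data Unknown : Set where
    `s `α `β `g : Unknown

  -- `s, `α, `β generate the walks from 1 to S, U, U² whose last visit to 1 is their
  -- start, and `g those from 1 to 1.
  system : (Unknown → Carrier) → Unknown → Carrier
  system F `s = y + x * (F `β * F `s)
  system F `α = x + y * (F `s * F `α)
  system F `β = x * F `α + y * (F `s * F `β)
  system F `g = 1# + (x * (F `β * F `g) + y * (F `s * F `g))

  -- Every unknown on the right stands under a factor `x` or `y`, which raises the degree of
  -- agreement by one.
  system-contractive : Contractive system
  system-contractive {k} {F} {G} h i = contract i
    where
    product : ∀ i j → F i * F j ≈[ k ] G i * G j
    product i j = *-cong[] (F i) (G i) (F j) (G j) (h i) (h j)
    x* : ∀ i j → x * (F i * F j) ≈[ suc k ] x * (G i * G j)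
    x* i j = x-cong[] (F i * F j) (G i * G j) (product i j)
    y* : ∀ i j → y * (F i * F j) ≈[ suc k ] y * (G i * G j)
    y* i j = y-cong[] (F i * F j) (G i * G j) (product i j)
    contract : ∀ i → system F i ≈[ suc k ] system G i
    contract `s = +-cong[] {f = y} (λ _ _ _ → refl) (x* `β `s)
    contract `α = +-cong[] {f = x} (λ _ _ _ → refl) (y* `s `α)
    contract `β = +-cong[] {f = x * F `α} (x-cong[] (F `α) (G `α) (h `α)) (y* `s `β)
    contract `g = +-cong[] {f = 1#} (λ _ _ _ → refl) (+-cong[] {f = x * (F `β * F `g)} (x* `β `g) (y* `s `g))

  -- Abstract: unfolding the iteration makes type checking infeasible.
  abstract
    solution : Unknown → Carrier
    solution = fixedPoint system system-contractive

    solution-fixed : ∀ i → solution i ≈ system solution i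
    solution-fixed = fixedPoint-fixed system system-contractive

  open Equation.System ℚ[[x,y]]-ring x y (solution `s) (solution `α) (solution `β) (solution `g)
    (solution-fixed `s) (solution-fixed `α) (solution-fixed `β) (solution-fixed `g) public

  step : (NF → Carrier) → NF → Carrier
  step F n = δ n + (x * F (actU (actU n)) + y * F (actS n))

  step-contractive : Contractive step
  step-contractive {F = F} {G} h n = +-cong[] {f = δ n} (λ _ _ _ → refl)
    (+-cong[] {f = x * F (actU (actU n))} (x-cong[] (F u) (G u) (h u)) (y-cong[] (F s) (G s) (h s)))
    where
    u = actU (actU n)
    s = actS n

  -- `weight` solves the same linear system over all normal forms, and `step` is contractive. At the
  -- identity the product of syllables is empty, which leaves `g`.
  weight-unique : ∀ F → (∀ n → F n ≈ step F n) → F (e0 , one) ≈ solution `g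
  weight-unique F h = R.trans {F o} {weight o} {solution `g}
    (fixedPoint-unique step step-contractive {F} {weight} h weight-step o)
    (IntegerSolver.solve ℚ[[x,y]]-ring 1 (λ g → g :* (con (+ 1) :* con (+ 1)) := g) R.refl (solution `g))
    where
    open IntegerSolver ℚ[[x,y]]-ring using (_:*_; _:=_; con)
    o = e0 , one

-- Restriction to x = y as a ring homomorphism

module Diagonal where
  open import Relation.Binary.PropositionalEquality using (refl; sym; trans)
  private
    module Y = PowerSeries ℚ-ring
    module S = PowerSeries ℚ[[x]]-ring
    module ℚy = CommutativeRing ℚ[[x]]-ring
    module R = CommutativeRing ℚ[[x,y]]-ring
    module B = Bivariate
    X₁ = Univariate.x
    D = diagonal
  open IntegerSolver ℚ-ring using (solve; _:=_; _:+_; _:*_; :-_; con)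

  diagonal-cong : ∀ {f g} → f B.≈ g → D f ℚy.≈ D g
  diagonal-cong h zero    = cong (ℚ._+ ℚ.0ℚ) (h 0 0)
  diagonal-cong h (suc n) = cong₂ ℚ._+_ (h 0 (suc n)) (diagonal-cong (h ∘ suc) n)

  diagonal-+ : ∀ f g → D (f B.+ g) ℚy.≈ D f ℚy.+ D g
  diagonal-+ f g zero    = solve 2 (λ a b → a :+ b :+ con (+ 0) := (a :+ con (+ 0)) :+ (b :+ con (+ 0))) refl (f 0 0) (g 0 0)
  diagonal-+ f g (suc n) = trans (cong (ℚ._+_ (f 0 (suc n) ℚ.+ g 0 (suc n))) (diagonal-+ (f ∘ suc) (g ∘ suc) n))
    (solve 4 (λ a b c d → (a :+ b) :+ (c :+ d) := (a :+ c) :+ (b :+ d)) refl (f 0 (suc n)) (g 0 (suc n)) (D (f ∘ suc) n) (D (g ∘ suc) n))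

  diagonal-neg : ∀ f → D (B.- f) ℚy.≈ ℚy.- D f
  diagonal-neg f zero    = solve 1 (λ a → :- a :+ con (+ 0) := :- (a :+ con (+ 0))) refl (f 0 0)
  diagonal-neg f (suc n) = trans (cong (ℚ._+_ (ℚ.- f 0 (suc n))) (diagonal-neg (f ∘ suc) n))
    (solve 2 (λ a b → :- a :+ :- b := :- (a :+ b)) refl (f 0 (suc n)) (D (f ∘ suc) n))

  -- Horner's scheme in the outer variable; it turns the recursion of `diagonal` on coefficients
  -- into an identity of series.
  diagonal-split : ∀ f → D f ℚy.≈ f 0 ℚy.+ X₁ ℚy.* D (f ∘ suc)
  diagonal-split f zero    = cong (ℚ._+_ (f 0 0)) (sym (Y.X-*-zero (D (f ∘ suc))))
  diagonal-split f (suc n) = cong (ℚ._+_ (f 0 (suc n))) (sym (Y.X-*-suc (D (f ∘ suc)) n))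

  private
    open IntegerSolver ℚ[[x]]-ring using () renaming (solve to solveY; _:=_ to _:=′_; _:+_ to _:+′_; _:*_ to _:*′_)

    *-diagonal-suc : ∀ a f n → (a ℚy.* D f) (suc n) ≡ (a ℚy.* f 0) (suc n) ℚ.+ (a ℚy.* D (f ∘ suc)) n
    *-diagonal-suc a f n = trans (ℚy.*-congˡ {a} {D f} {f 0 ℚy.+ X₁ ℚy.* D (f ∘ suc)} (diagonal-split f) (suc n)) (trans
      (solveY 4 (λ a b x d → a :*′ (b :+′ x :*′ d) :=′ a :*′ b :+′ x :*′ (a :*′ d)) ℚy.refl a (f 0) X₁ (D (f ∘ suc)) (suc n))
      (cong (ℚ._+_ ((a ℚy.* f 0) (suc n))) (Y.X-*-suc (a ℚy.* D (f ∘ suc)) n)))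

  diagonal-scale : ∀ a f → D (S.scale a f) ℚy.≈ a ℚy.* D f
  diagonal-scale a f zero    = solve 2 (λ a f → a :* f :+ con (+ 0) :+ con (+ 0) := a :* (f :+ con (+ 0)) :+ con (+ 0))
    refl (a 0) (f 0 0)
  diagonal-scale a f (suc n) = trans (cong (ℚ._+_ ((a ℚy.* f 0) (suc n))) (diagonal-scale a (f ∘ suc) n)) (sym (*-diagonal-suc a f n))

  -- As functions of `f`, both sides satisfy P(f) = f 0 · D g + x · P(f ∘ suc): the left one by the
  -- recursion of the product, the right one by `diagonal-split`.
  diagonal-* : ∀ f g → D (f B.* g) ℚy.≈ D f ℚy.* D g
  diagonal-* f g zero = solve 2
    (λ a b → a :* b :+ con (+ 0) :+ con (+ 0) :+ con (+ 0) := (a :+ con (+ 0)) :* (b :+ con (+ 0)) :+ con (+ 0))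
    refl (f 0 0) (g 0 0)
  diagonal-* f g (suc n) = begin
    ((f 0 ℚy.* g 0) (suc n) ℚ.+ ℚ.0ℚ) ℚ.+ D (S.scale (f 0) (g ∘ suc) B.+ (f ∘ suc) B.* g) n
      ≡⟨ cong (ℚ._+_ ((f 0 ℚy.* g 0) (suc n) ℚ.+ ℚ.0ℚ)) (trans (diagonal-+ (S.scale (f 0) (g ∘ suc)) ((f ∘ suc) B.* g) n)
           (cong₂ ℚ._+_ (diagonal-scale (f 0) (g ∘ suc) n) (diagonal-* (f ∘ suc) g n))) ⟩
    ((f 0 ℚy.* g 0) (suc n) ℚ.+ ℚ.0ℚ) ℚ.+ ((f 0 ℚy.* D (g ∘ suc)) n ℚ.+ (D (f ∘ suc) ℚy.* D g) n)
      ≡⟨ solve 3 (λ a b c → (a :+ con (+ 0)) :+ (b :+ c) := (a :+ b) :+ c) refl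
           ((f 0 ℚy.* g 0) (suc n)) ((f 0 ℚy.* D (g ∘ suc)) n) ((D (f ∘ suc) ℚy.* D g) n) ⟩
    ((f 0 ℚy.* g 0) (suc n) ℚ.+ (f 0 ℚy.* D (g ∘ suc)) n) ℚ.+ (D (f ∘ suc) ℚy.* D g) n
      ≡⟨ cong₂ ℚ._+_ (*-diagonal-suc (f 0) g n) (Y.X-*-suc (D (f ∘ suc) ℚy.* D g) n) ⟨
    (f 0 ℚy.* D g) (suc n) ℚ.+ (X₁ ℚy.* (D (f ∘ suc) ℚy.* D g)) (suc n)
      ≡⟨ solveY 4 (λ a x b d → (a :+′ x :*′ b) :*′ d :=′ a :*′ d :+′ x :*′ (b :*′ d)) ℚy.refl (f 0) X₁ (D (f ∘ suc)) (D g) (suc n) ⟨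
    ((f 0 ℚy.+ X₁ ℚy.* D (f ∘ suc)) ℚy.* D g) (suc n)
      ≡⟨ ℚy.*-congʳ {D g} {D f} {f 0 ℚy.+ X₁ ℚy.* D (f ∘ suc)} (diagonal-split f) (suc n) ⟨
    (D f ℚy.* D g) (suc n) ∎
    where open ≡.≡-Reasoning

  diagonal-constant : ∀ a → D (constant ℚ[[x]] a) ℚy.≈ a
  diagonal-constant a zero    = ℚ.+-identityʳ (a 0)
  diagonal-constant a (suc n) = trans (cong (ℚ._+_ (a (suc n))) (diagonal-0 n)) (ℚ.+-identityʳ _)
    where
    diagonal-0 : D B.0# ℚy.≈ ℚy.0#
    diagonal-0 zero    = refl
    diagonal-0 (suc n) = cong (ℚ._+_ ℚ.0ℚ) (diagonal-0 n)

  diagonal-0 : D B.0# ℚy.≈ ℚy.0#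
  diagonal-0 = ℚy.trans {D B.0#} {D (constant ℚ[[x]] ℚy.0#)} {ℚy.0#}
    (diagonal-cong {B.0#} {constant ℚ[[x]] ℚy.0#} λ { zero _ → refl ; (suc _) _ → refl }) (diagonal-constant ℚy.0#)

  diagonal-1 : D B.1# ℚy.≈ ℚy.1#
  diagonal-1 = ℚy.trans {D B.1#} {D (constant ℚ[[x]] ℚy.1#)} {ℚy.1#}
    (diagonal-cong {B.1#} {constant ℚ[[x]] ℚy.1#} λ { zero _ → refl ; (suc _) _ → refl }) (diagonal-constant ℚy.1#)

  diagonal-x-* : ∀ f → D (B.x B.* f) ℚy.≈ X₁ ℚy.* D f
  diagonal-x-* f zero = trans (cong (ℚ._+ ℚ.0ℚ) (WalkSystem.x-*-zero f 0)) (sym (Y.X-*-zero (D f)))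
  diagonal-x-* f (suc n) = trans (cong₂ ℚ._+_ (WalkSystem.x-*-zero f (suc n)) (diagonal-cong {(B.x B.* f) ∘ suc} {f} (WalkSystem.x-*-suc f) n))
    (trans (ℚ.+-identityˡ _) (sym (Y.X-*-suc (D f) n)))

  diagonal-y : D B.y ℚy.≈ X₁
  diagonal-y = diagonal-constant X₁

  diagonal-x : D B.x ℚy.≈ X₁
  diagonal-x = begin
    D B.x                   ≈⟨ diagonal-cong {B.x} {B.x B.* B.1#} (R.sym {B.x B.* B.1#} {B.x} (R.*-identityʳ B.x)) ⟩
    D (B.x B.* B.1#)        ≈⟨ diagonal-x-* B.1# ⟩
    X₁ ℚy.* D B.1#          ≈⟨ ℚy.*-congˡ {X₁} {D B.1#} {ℚy.1#} diagonal-1 ⟩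
    X₁ ℚy.* ℚy.1#           ≈⟨ ℚy.*-identityʳ X₁ ⟩
    X₁                      ∎
    where open SetoidReasoning ℚy.setoid

  restriction : Specialisation ℚ[[x,y]]-ring ℚ[[x]]-ring 0ℓ
  restriction = record
    { _⇝_    = λ f a → D f ℚy.≈ a
    ; +-⇝    = λ {f} {g} {a} {b} h k → ℚy.trans {D (f B.+ g)} {D f ℚy.+ D g} {a ℚy.+ b} (diagonal-+ f g) (ℚy.+-cong {D f} {a} {D g} {b} h k)
    ; *-⇝    = λ {f} {g} {a} {b} h k → ℚy.trans {D (f B.* g)} {D f ℚy.* D g} {a ℚy.* b} (diagonal-* f g) (ℚy.*-cong {D f} {a} {D g} {b} h k)
    ; -‿⇝    = λ {f} {a} h → ℚy.trans {D (B.- f)} {ℚy.- D f} {ℚy.- a} (diagonal-neg f) (ℚy.-‿cong {D f} {a} h)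
    ; zero-⇝ = λ {f} {a} h f≈0 → ℚy.trans {a} {D f} {ℚy.0#} (ℚy.sym {D f} {a} h)
        (ℚy.trans {D f} {D B.0#} {ℚy.0#} (diagonal-cong {f} {B.0#} f≈0) diagonal-0)
    }

-- Counting words as walks on normal forms

module Counting where
  open import Relation.Binary.PropositionalEquality using (refl; sym; trans)
  open Rationals using (ι; ι-+)

  count : ∀ {p} {A : Set} {P : Pred A p} → Decidable P → List A → ℕ
  count P? xs = length (filter P? xs)

  count-map : ∀ {p} {A B : Set} {P : Pred B p} (P? : Decidable P) (f : A → B) xs →
    count P? (map f xs) ≡ count (λ a → P? (f a)) xs
  count-map P? f []       = refl
  count-map P? f (x ∷ xs) with does (P? (f x))
  ... | true  = cong suc (count-map P? f xs)
  ... | false = count-map P? f xs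

  count-words : ∀ {p} {P : Pred Word p} (P? : Decidable P) n →
    count P? (words (suc n)) ≡ count (λ w → P? (U ∷ w)) (words n) ℕ.+ count (λ w → P? (S ∷ w)) (words n)
  count-words P? n = begin
    count P? (map (U ∷_) (words n) ++ (map (S ∷_) (words n) ++ []))
      ≡⟨ cong (count P?) (cong (map (U ∷_) (words n) ++_) (List.++-identityʳ (map (S ∷_) (words n)))) ⟩
    count P? (map (U ∷_) (words n) ++ map (S ∷_) (words n))
      ≡⟨ cong length (List.filter-++ P? (map (U ∷_) (words n)) (map (S ∷_) (words n))) ⟩
    length (filter P? (map (U ∷_) (words n)) ++ filter P? (map (S ∷_) (words n)))
      ≡⟨ List.length-++ (filter P? (map (U ∷_) (words n))) ⟩
    count P? (map (U ∷_) (words n)) ℕ.+ count P? (map (S ∷_) (words n))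
      ≡⟨ cong₂ ℕ._+_ (count-map P? (U ∷_) (words n)) (count-map P? (S ∷_) (words n)) ⟩
    count (λ w → P? (U ∷ w)) (words n) ℕ.+ count (λ w → P? (S ∷ w)) (words n) ∎
    where open ≡.≡-Reasoning

  count-≐ : ∀ {p q} {A : Set} {P : Pred A p} {Q : Pred A q} (P? : Decidable P) (Q? : Decidable Q) →
    P ≐ Q → ∀ xs → count P? xs ≡ count Q? xs
  count-≐ P? Q? P≐Q xs = cong length (List.filter-≐ P? Q? P≐Q xs)

  count-none : ∀ {p} {A : Set} {P : Pred A p} (P? : Decidable P) → (∀ a → ¬ P a) → ∀ xs → count P? xs ≡ 0
  count-none P? ¬P xs = cong length (List.filter-none P? (All.universal ¬P xs))

  o : NF
  o = e0 , one

  -- Words leading from 1 to v; stated through act⁻¹, so that it is decided by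
  -- comparison with 1 and unfolds along the first letter of the word.
  Reaches : NF → Pred Word 0ℓ
  Reaches v w = act⁻¹ ⟦ w ⟧ v ≡ o

  reaches? : ∀ v → Decidable (Reaches v)
  reaches? v w = trivialNF? (act⁻¹ ⟦ w ⟧ v)

  -- A word fixes the empty normal form iff its inverse does, and by `nf-trivial` only trivial
  -- elements fix it.
  trivial≐reaches : IsTrivial ≐ Reaches o
  trivial≐reaches =
    (λ {w} h → trans (cong (act⁻¹ ⟦ w ⟧) (sym (act-cong h o))) (act⁻¹-act ⟦ w ⟧ o)) ,
    (λ {w} h → nf-trivial ⟦ w ⟧ (trans (cong (act ⟦ w ⟧) (sym h)) (act-act⁻¹ ⟦ w ⟧ o)))

  Reaches₂ : NF → ℕ → ℕ → Pred Word 0ℓ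
  Reaches₂ v n m w = #U w ≡ n × #S w ≡ m × Reaches v w

  reaches₂? : ∀ v n m → Decidable (Reaches₂ v n m)
  reaches₂? v n m w = (#U w ℕ.≟ n) ×-dec (#S w ℕ.≟ m) ×-dec reaches? v w

  walks : NF → ℕ → ℕ
  walks v n = count (reaches? v) (words n)

  walks₂ : NF → ℕ → ℕ → ℕ
  walks₂ v n m = count (reaches₂? v n m) (words (n ℕ.+ m))

  t≡walks : ∀ n → t n ≡ walks o n
  t≡walks n = count-≐ trivial? (reaches? o) trivial≐reaches (words n)

  q≡walks₂ : ∀ n m → q n m ≡ walks₂ o n m
  q≡walks₂ n m = count-≐ (λ w → (#U w ℕ.≟ n) ×-dec (#S w ℕ.≟ m) ×-dec trivial? w) (reaches₂? o n m)
    ( (λ { {w} (a , b , h) → a , b , proj₁ trivial≐reaches {w} h })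
    , (λ { {w} (a , b , h) → a , b , proj₂ trivial≐reaches {w} h }) ) (words (n ℕ.+ m))

  walks-suc : ∀ v n → walks v (suc n) ≡ walks (actU (actU v)) n ℕ.+ walks (actS v) n
  walks-suc v n = count-words (reaches? v) n

  module _ (v : NF) where
    private
      u = actU (actU v)
      s = actS v

    U-suc : ∀ n m ws → count (λ w → reaches₂? v (suc n) m (U ∷ w)) ws ≡ count (reaches₂? u n m) ws
    U-suc n m = count-≐ (λ w → reaches₂? v (suc n) m (U ∷ w)) (reaches₂? u n m)
      ((λ { (a , b) → ℕ.suc-injective a , b }) , (λ { (a , b) → cong suc a , b }))

    S-suc : ∀ n m ws → count (λ w → reaches₂? v n (suc m) (S ∷ w)) ws ≡ count (reaches₂? s n m) ws
    S-suc n m = count-≐ (λ w → reaches₂? v n (suc m) (S ∷ w)) (reaches₂? s n m)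
      ((λ { (a , b , h) → a , ℕ.suc-injective b , h }) , (λ { (a , b , h) → a , cong suc b , h }))

    U-zero : ∀ m ws → count (λ w → reaches₂? v 0 m (U ∷ w)) ws ≡ 0
    U-zero m = count-none (λ w → reaches₂? v 0 m (U ∷ w)) (λ { _ (() , _) })

    S-zero : ∀ n ws → count (λ w → reaches₂? v n 0 (S ∷ w)) ws ≡ 0
    S-zero n = count-none (λ w → reaches₂? v n 0 (S ∷ w)) (λ { _ (_ , () , _) })

    walks₂-zero : walks₂ v 0 0 ≡ walks v 0
    walks₂-zero with trivialNF? v
    ... | yes _ = refl
    ... | no _  = refl

    walks₂-0-suc : ∀ m → walks₂ v 0 (suc m) ≡ walks₂ s 0 m
    walks₂-0-suc m = trans (count-words (reaches₂? v 0 (suc m)) m)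
      (cong₂ ℕ._+_ (U-zero (suc m) (words m)) (S-suc 0 m (words m)))

    walks₂-suc-0 : ∀ n → walks₂ v (suc n) 0 ≡ walks₂ u n 0
    walks₂-suc-0 n = trans (count-words (reaches₂? v (suc n) 0) (n ℕ.+ 0))
      (trans (cong₂ ℕ._+_ (U-suc n 0 (words (n ℕ.+ 0))) (S-zero (suc n) (words (n ℕ.+ 0)))) (ℕ.+-identityʳ _))

    walks₂-suc-suc : ∀ n m → walks₂ v (suc n) (suc m) ≡ walks₂ u n (suc m) ℕ.+ walks₂ s (suc n) m
    walks₂-suc-suc n m = trans (count-words (reaches₂? v (suc n) (suc m)) (n ℕ.+ suc m))
      (cong₂ ℕ._+_ (U-suc n (suc m) (words (n ℕ.+ suc m)))
        (trans (S-suc (suc n) m (words (n ℕ.+ suc m)))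
               -- The remaining words have length `n ℕ.+ suc m`, while `walks₂ s (suc n) m` ranges
               -- over length `suc (n ℕ.+ m)`.
               (cong (λ k → count (reaches₂? s (suc n) m) (words k)) (ℕ.+-suc n m))))

  walkSeries : NF → Bivariate.Carrier
  walkSeries v n m = ι (+ walks₂ v n m)

  δ-zero : ∀ v → ι (+ walks v 0) ≡ WalkSystem.δ v 0 0
  δ-zero (e0 , one)    = refl
  δ-zero (e0 , lone-S) = refl
  δ-zero (e0 , su _)   = refl
  δ-zero (e0 , su² _)  = refl
  δ-zero (e1 , _)      = refl
  δ-zero (e2 , _)      = refl

  δ-suc : ∀ v n m → WalkSystem.δ v (suc n) m ≡ ℚ.0ℚ
  δ-suc (e0 , one)    n m = refl
  δ-suc (e0 , lone-S) n m = refl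
  δ-suc (e0 , su _)   n m = refl
  δ-suc (e0 , su² _)  n m = refl
  δ-suc (e1 , _)      n m = refl
  δ-suc (e2 , _)      n m = refl

  δ-0-suc : ∀ v m → WalkSystem.δ v 0 (suc m) ≡ ℚ.0ℚ
  δ-0-suc (e0 , one)    m = refl
  δ-0-suc (e0 , lone-S) m = refl
  δ-0-suc (e0 , su _)   m = refl
  δ-0-suc (e0 , su² _)  m = refl
  δ-0-suc (e1 , _)      m = refl
  δ-0-suc (e2 , _)      m = refl

  walkSeries-step : ∀ v → walkSeries v Bivariate.≈ WalkSystem.step walkSeries v
  walkSeries-step v n m = trans (go n m) (cong₂ ℚ._+_ (sym (δ-at n m)) (cong₂ ℚ._+_ (sym (x-at n m)) (sym (y-at n m))))
    where
    f = walkSeries (actU (actU v))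
    g = walkSeries (actS v)
    -- The coefficients of the three summands by pattern matching: multiplication by x or y shifts
    -- one index and leaves 0 on the boundary, which gives the four cases of `go`.
    δ′ x′ y′ : ℕ → ℕ → ℚ.ℚ
    δ′ zero zero = ι (+ walks v 0)
    δ′ zero (suc _) = ℚ.0ℚ
    δ′ (suc _) _    = ℚ.0ℚ
    x′ zero m = ℚ.0ℚ
    x′ (suc n) m = f n m
    y′ n zero = ℚ.0ℚ
    y′ n (suc m) = g n m
    δ-at : ∀ n m → WalkSystem.δ v n m ≡ δ′ n m
    δ-at zero zero = sym (δ-zero v)
    δ-at zero (suc m) = δ-0-suc v m
    δ-at (suc n) m = δ-suc v n m
    x-at : ∀ n m → (Bivariate.x Bivariate.* f) n m ≡ x′ n m
    x-at zero m = WalkSystem.x-*-zero f m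
    x-at (suc n) m = WalkSystem.x-*-suc f n m
    y-at : ∀ n m → (Bivariate.y Bivariate.* g) n m ≡ y′ n m
    y-at n zero = WalkSystem.y-*-zero g n
    y-at n (suc m) = WalkSystem.y-*-suc g n m
    go : ∀ n m → walkSeries v n m ≡ δ′ n m ℚ.+ (x′ n m ℚ.+ y′ n m)
    go zero zero = trans (cong (λ k → ι (+ k)) (walks₂-zero v)) (sym (ℚ.+-identityʳ _))
    go zero (suc m) = trans (cong (λ k → ι (+ k)) (walks₂-0-suc v m))
      (sym (trans (ℚ.+-identityˡ _) (ℚ.+-identityˡ _)))
    go (suc n) zero = trans (cong (λ k → ι (+ k)) (walks₂-suc-0 v n))
      (sym (trans (ℚ.+-identityˡ _) (ℚ.+-identityʳ _)))
    go (suc n) (suc m) = trans (cong (λ k → ι (+ k)) (walks₂-suc-suc v n m))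
      (trans (ι-+ (+ walks₂ (actU (actU v)) n (suc m)) (+ walks₂ (actS v) (suc n) m)) (sym (ℚ.+-identityˡ _)))

  Q≈walkSeries : Q Bivariate.≈ walkSeries o
  Q≈walkSeries n m = cong (λ k → ι (+ k)) (q≡walks₂ n m)

  -- Induction on the length for all endpoints at once, instead of sorting the words of length n by
  -- their number of U: restriction to x = y turns the equation of `walkSeries` into the recursion
  -- of `walks`.
  diagonal-walkSeries : ∀ n v → diagonal (walkSeries v) n ≡ ι (+ walks v n)
  diagonal-walkSeries zero v = trans (ℚ.+-identityʳ _) (cong (λ k → ι (+ k)) (walks₂-zero v))
  diagonal-walkSeries (suc n) v = begin
    D (walkSeries v) (suc n)
      ≡⟨ D.diagonal-cong {walkSeries v} {WalkSystem.step walkSeries v} (walkSeries-step v) (suc n) ⟩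
    D (WalkSystem.δ v B.+ (B.x B.* f B.+ B.y B.* g)) (suc n)
      ≡⟨ D.diagonal-+ (WalkSystem.δ v) (B.x B.* f B.+ B.y B.* g) (suc n) ⟩
    D (WalkSystem.δ v) (suc n) ℚ.+ D (B.x B.* f B.+ B.y B.* g) (suc n)
      ≡⟨ cong₂ ℚ._+_ (diagonal-δ n v) (D.diagonal-+ (B.x B.* f) (B.y B.* g) (suc n)) ⟩
    ℚ.0ℚ ℚ.+ (D (B.x B.* f) (suc n) ℚ.+ D (B.y B.* g) (suc n))
      ≡⟨ ℚ.+-identityˡ _ ⟩
    D (B.x B.* f) (suc n) ℚ.+ D (B.y B.* g) (suc n)
      ≡⟨ cong₂ ℚ._+_ (trans (D.diagonal-x-* f (suc n)) (Y.X-*-suc (D f) n))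
                     (trans (D.diagonal-* B.y g (suc n)) (trans
                       (Y.*-cong {D B.y} {Univariate.x} {D g} {D g} D.diagonal-y (λ _ → refl) (suc n)) (Y.X-*-suc (D g) n))) ⟩
    D f n ℚ.+ D g n
      ≡⟨ cong₂ ℚ._+_ (diagonal-walkSeries n (actU (actU v))) (diagonal-walkSeries n (actS v)) ⟩
    ι (+ walks (actU (actU v)) n) ℚ.+ ι (+ walks (actS v) n)
      ≡⟨ ι-+ (+ walks (actU (actU v)) n) (+ walks (actS v) n) ⟨
    ι (+ (walks (actU (actU v)) n ℕ.+ walks (actS v) n))
      ≡⟨ cong (λ k → ι (+ k)) (walks-suc v n) ⟨
    ι (+ walks v (suc n)) ∎
    where
    open ≡.≡-Reasoning
    module B = Bivariate
    module D = Diagonal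
    module Y = PowerSeries ℚ-ring
    D = diagonal
    f = walkSeries (actU (actU v))
    g = walkSeries (actS v)
    zero-diagonal : ∀ n f → (∀ k l → f k l ≡ ℚ.0ℚ) → diagonal f n ≡ ℚ.0ℚ
    zero-diagonal n f h = trans (D.diagonal-cong {f} {B.0#} h n) (D.diagonal-0 n)
    diagonal-δ : ∀ n v → D (WalkSystem.δ v) (suc n) ≡ ℚ.0ℚ
    diagonal-δ n v = trans (cong₂ ℚ._+_ (δ-0-suc v n) (zero-diagonal n (WalkSystem.δ v ∘ suc) (δ-suc v)))
      (ℚ.+-identityʳ _)

  T≈diagonal : T Univariate.≈ diagonal Q
  T≈diagonal n = trans (cong (λ k → ι (+ k)) (t≡walks n)) (trans (sym (diagonal-walkSeries n o))
    (Diagonal.diagonal-cong {walkSeries o} {Q} (λ k l → sym (Q≈walkSeries k l)) n))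

-- Anisotropy of the norm over polynomials

module CoefficientDescent (A : CommutativeRing c ℓ)
  (K : Pred (CommutativeRing.Carrier A) κ)
  (K-+ : ∀ {a b} → K a → K b → K (CommutativeRing._+_ A a b)) where

  private B = PowerSeries.commutativeRing A
  open FiniteSupport A
  module C = Coefficients (CommutativeRing.rawRing B)
  module C′ = Coefficients (CommutativeRing.rawRing A)

  Polynomial : Pred (CommutativeRing.Carrier B) _
  Polynomial f = ∃[ N ] Bounded K K-+ N f

  -- One use sets the outer variable to 1. The coefficients are built by ring operations, so they
  -- specialise to the same expressions in the specialised arguments.
  lift : ∀ {f g a b} → f ⇝ a → g ⇝ b → CubicNorm.Anisotropic A K (C′.coefficients a b) →
    CubicNorm.Anisotropic B Polynomial (C.coefficients f g)
  lift {f} {g} {a} {b} h k = anisotropic-series K K-+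
    (coefficient₁-⇝ atOne {f} {g} {a} {b} 0-⇝ 1-⇝ h k)
    (coefficient₂-⇝ atOne {f} {g} {a} {b} 0-⇝ 1-⇝ h k)
    (coefficient₃-⇝ atOne {f} {g} {a} {b} 0-⇝ 1-⇝ h k)

module Polynomials where
  open import Relation.Binary.PropositionalEquality using (refl; sym; trans)
  open Rationals using (anisotropic-ℚ; ι)
  open CommutativeRing using (rawRing)
  private
    module F₁ = FiniteSupport ℚ-ring
    module F₂ = FiniteSupport ℚ[[x]]-ring
    module Y = Univariate
    module B = Bivariate

  -- Bounding the degree in each variable separately reduces closure under products to `supported-*`
  -- in one variable at a time; the total degree is bounded only afterwards.
  Box : ℕ → Pred B.Carrier 0ℓ
  Box N f = F₂.SupportedBelow N f × ∀ n → F₁.SupportedBelow N (f n)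

  box⇒polynomial : ∀ {N f} → Box N f → B.IsPolynomial f
  box⇒polynomial {N} {f} (h , k) = N ℕ.+ N , λ n m le → vanish n m le (ℕ.≤-total N n)
    where
    vanish : ∀ n m → N ℕ.+ N ≤ n ℕ.+ m → N ≤ n ⊎ n ≤ N → f n m ≡ ℚ.0ℚ
    vanish n m le (inj₁ N≤n) = h n N≤n m
    vanish n m le (inj₂ n≤N) = k n m (ℕ.+-cancelˡ-≤ N N m (ℕ.≤-trans le (ℕ.+-monoˡ-≤ m n≤N)))

  IsBox : Pred B.Carrier 0ℓ
  IsBox f = ∃[ N ] Box N f

  box-+ : ∀ f g → IsBox f → IsBox g → IsBox (f B.+ g)
  box-+ f g (M , h , k) (N , h′ , k′) = M ℕ.+ N , F₂.supported-+ {M} {f = f} h h′ ,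
    λ n → F₁.supported-+ {M} {f = f n} (k n) (k′ n)

  box-neg : ∀ f → IsBox f → IsBox (B.- f)
  box-neg f (M , h , k) = M , F₂.supported-neg {f = f} h , λ n → F₁.supported-neg {f = f n} (k n)

  box-* : ∀ f g → IsBox f → IsBox g → IsBox (f B.* g)
  box-* f g (M , h , k) (N , h′ , k′) = M ℕ.+ N , F₂.supported-* M {f = f} {g} h h′ , coefficient f k
    where
    coefficient : ∀ f → (∀ n → F₁.SupportedBelow M (f n)) → ∀ n → F₁.SupportedBelow (M ℕ.+ N) ((f B.* g) n)
    coefficient f k zero    m le = trans (ℚ.+-identityʳ _) (F₁.supported-* M {f = f 0} {g 0} (k 0) (k′ 0) m le)
    coefficient f k (suc n) m le = trans
      (cong₂ ℚ._+_ (F₁.supported-* M {f = f 0} {g (suc n)} (k 0) (k′ (suc n)) m le)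
                   (coefficient (f ∘ suc) (k ∘ suc) n m le))
      (ℚ.+-identityʳ _)

  box-0 : IsBox B.0#
  box-0 = 0 , (λ _ _ _ → refl) , λ _ _ _ → refl

  box-1 : IsBox B.1#
  box-1 = 1 , (λ { (suc _) _ _ → refl }) , λ { zero (suc _) _ → refl ; (suc _) _ _ → refl }

  box-x : IsBox B.x
  box-x = 2 , F₂.supported-x ,
    λ { zero _ _ → refl ; (suc zero) (suc _) _ → refl ; (suc (suc _)) _ _ → refl }

  box-y : IsBox B.y
  box-y = 2 , (λ { (suc _) _ _ → refl }) , λ { zero → F₁.supported-x ; (suc _) _ _ → refl }

  module C₀ = Coefficients (rawRing ℚ-ring)
  module P₁ = CoefficientDescent ℚ-ring (λ _ → ⊤) (λ _ _ → tt)

  polynomial-+ : ∀ {f g} → P₁.Polynomial f → P₁.Polynomial g → P₁.Polynomial (f Y.+ g)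
  polynomial-+ {f} (M , h , _) (N , k , _) = M ℕ.+ N , F₁.supported-+ {M} {f = f} h k , _

  module P₂ = CoefficientDescent ℚ[[x]]-ring P₁.Polynomial polynomial-+

  opaque
    unfolding Coefficients.coefficient₁ Coefficients.coefficient₂ Coefficients.coefficient₃

    coefficients-at-1 : C₀.coefficients ℚ.1ℚ ℚ.1ℚ ≡ (ι (+ 1) , ι (+ 2) , ι (+ 7))
    coefficients-at-1 = refl

  anisotropic-at-1 : CubicNorm.Anisotropic ℚ-ring (λ _ → ⊤) (C₀.coefficients ℚ.1ℚ ℚ.1ℚ)
  anisotropic-at-1 = ≡.subst (CubicNorm.Anisotropic ℚ-ring (λ _ → ⊤)) (sym coefficients-at-1) anisotropic-ℚ

  anisotropic-T : CubicNorm.Anisotropic ℚ[[x]]-ring Y.IsPolynomial (P₁.C.coefficients Y.x Y.x)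
  anisotropic-T = CubicNorm.anisotropic-⊆ ℚ[[x]]-ring {K = Y.IsPolynomial} {P₁.Polynomial}
    {P₁.C.coefficients Y.x Y.x} (λ f (N , h) → N , h , _)
    (P₁.lift {Y.x} {Y.x} {ℚ.1ℚ} {ℚ.1ℚ} F₁.x-⇝ F₁.x-⇝ anisotropic-at-1)

  anisotropic-Q : CubicNorm.Anisotropic ℚ[[x,y]]-ring B.IsPolynomial (P₂.C.coefficients B.x B.y)
  anisotropic-Q = CubicNorm.anisotropic-⊆ ℚ[[x,y]]-ring {K = B.IsPolynomial} {P₂.Polynomial}
    {P₂.C.coefficients B.x B.y} bounded
    -- The outer variable x becomes 1 while y, a constant series in x, survives as the variable
    -- `Y.x` of the coefficient ring; the inner `lift` then sets it to 1.
    (P₂.lift {B.x} {B.y} {Y.1#} {Y.x} F₂.x-⇝ (F₂.const-⇝ Y.x)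
      (P₁.lift {Y.1#} {Y.x} {ℚ.1ℚ} {ℚ.1ℚ} F₁.1-⇝ F₁.x-⇝ anisotropic-at-1))
    where
    bounded : ∀ f → B.IsPolynomial f → P₂.Polynomial f
    bounded f (N , h) = N , (λ n le m → h n m (ℕ.≤-trans le (ℕ.m≤m+n n m))) ,
      λ n → N , (λ m le → h n m (ℕ.≤-trans le (ℕ.m≤n+m m n))) , _

  open Equation

  polynomial₂ : B.IsPolynomial (P₂.C.coefficient₁ B.x B.y) ×
                B.IsPolynomial (P₂.C.coefficient₂ B.x B.y) ×
                B.IsPolynomial (P₂.C.coefficient₃ B.x B.y)
  polynomial₂ =
    let (_ , b₁) , (_ , b₂) , (_ , b₃) =
          coefficients-K ℚ[[x,y]]-ring IsBox box-0 box-1 box-+ box-* box-neg B.x B.y box-x box-y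
    in box⇒polynomial b₁ , box⇒polynomial b₂ , box⇒polynomial b₃

  polynomial₁ : Y.IsPolynomial (P₁.C.coefficient₁ Y.x Y.x) ×
                Y.IsPolynomial (P₁.C.coefficient₂ Y.x Y.x) ×
                Y.IsPolynomial (P₁.C.coefficient₃ Y.x Y.x)
  polynomial₁ = coefficients-K ℚ[[x]]-ring Y.IsPolynomial (0 , λ _ _ → refl) (1 , λ { (suc _) _ → refl })
    (λ f g (M , h) (N , k) → M ℕ.+ N , F₁.supported-+ {M} {f = f} h k)
    (λ f g (M , h) (N , k) → M ℕ.+ N , F₁.supported-* M {f = f} h k)
    (λ f (M , h) → M , F₁.supported-neg {f = f} h) Y.x Y.x (2 , F₁.supported-x) (2 , F₁.supported-x)

-- The cubic equations and the degree of `Q` and `T`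

module Main where
  open Polynomials
  open Counting
  open Equation
  private
    module Y = Univariate
    module B = Bivariate
    module R₁ = CommutativeRing ℚ[[x]]-ring
    module R₂ = CommutativeRing ℚ[[x,y]]-ring

  Q-root : CubicNorm.cubic ℚ[[x,y]]-ring (P₂.C.coefficients B.x B.y) Q B.≈ B.0#
  Q-root = R₂.trans {cubic Q} {cubic g} {B.0#}
    (CubicNorm.cubic-cong ℚ[[x,y]]-ring (P₂.C.coefficients B.x B.y) {Q} {g}
      (R₂.trans {Q} {walkSeries o} {g} Q≈walkSeries (WalkSystem.weight-unique walkSeries walkSeries-step)))
    WalkSystem.cubic-root
    where
    g = WalkSystem.solution WalkSystem.`g
    cubic = CubicNorm.cubic ℚ[[x,y]]-ring (P₂.C.coefficients B.x B.y)

  T-root : CubicNorm.cubic ℚ[[x]]-ring (P₁.C.coefficients Y.x Y.x) T Y.≈ Y.0#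
  T-root = zero-⇝ {CubicNorm.cubic ℚ[[x,y]]-ring (P₂.C.coefficients B.x B.y) Q}
    {CubicNorm.cubic ℚ[[x]]-ring (P₁.C.coefficients Y.x Y.x) T}
    (cubic-⇝ restriction
      {P₂.C.coefficient₁ B.x B.y} {P₂.C.coefficient₂ B.x B.y} {P₂.C.coefficient₃ B.x B.y} {Q}
      {P₁.C.coefficient₁ Y.x Y.x} {P₁.C.coefficient₂ Y.x Y.x} {P₁.C.coefficient₃ Y.x Y.x} {T}
      diagonal-1
      (coefficient₁-⇝ restriction {B.x} {B.y} {Y.x} {Y.x} diagonal-0 diagonal-1 diagonal-x diagonal-y)
      (coefficient₂-⇝ restriction {B.x} {B.y} {Y.x} {Y.x} diagonal-0 diagonal-1 diagonal-x diagonal-y)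
      (coefficient₃-⇝ restriction {B.x} {B.y} {Y.x} {Y.x} diagonal-0 diagonal-1 diagonal-x diagonal-y)
      (R₁.sym {T} {diagonal Q} T≈diagonal)) Q-root
    where
    open Diagonal
    open Specialisation restriction

  opaque
    unfolding Coefficients.coefficient₃

    -- The constant term is -1, and this is decided by computation.
    coefficient₃-nonzero₁ : ¬ P₁.C.coefficient₃ Y.x Y.x Y.≈ Y.0#
    coefficient₃-nonzero₁ h with () ← h 0

    coefficient₃-nonzero₂ : ¬ P₂.C.coefficient₃ B.x B.y B.≈ B.0#
    coefficient₃-nonzero₂ h with () ← h 0 0

  Q-algebraic : IsAlgebraicOfDegree ℚ[[x,y]] B.IsPolynomial 3 Q
  Q-algebraic = algebraicOfDegree3 ℚ[[x,y]]-ring B.IsPolynomial (box⇒polynomial (proj₂ box-0)) (box⇒polynomial (proj₂ box-1))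
    (P₂.C.coefficients B.x B.y) Q (proj₁ polynomial₂) (proj₁ (proj₂ polynomial₂)) (proj₂ (proj₂ polynomial₂))
    coefficient₃-nonzero₂ Q-root anisotropic-Q

  T-algebraic : IsAlgebraicOfDegree ℚ[[x]] Y.IsPolynomial 3 T
  T-algebraic = algebraicOfDegree3 ℚ[[x]]-ring Y.IsPolynomial (0 , λ _ _ → ≡.refl) (1 , λ { (suc _) _ → ≡.refl })
    (P₁.C.coefficients Y.x Y.x) T (proj₁ polynomial₁) (proj₁ (proj₂ polynomial₁)) (proj₂ (proj₂ polynomial₁))
    coefficient₃-nonzero₁ T-root anisotropic-T

  Q-isRoot : Coefficients.IsRoot ℚ[[x,y]] B.x B.y Q
  Q-isRoot = cubic⇒isRoot ℚ[[x,y]]-ring {B.x} {B.y} {Q} Q-root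

  T-isRoot : Coefficients.IsDiagonalRoot ℚ[[x]] Y.x T
  T-isRoot = cubic⇒isDiagonalRoot ℚ[[x]]-ring {Y.x} {T} T-root

mainTheorem1 : (let open Bivariate in
    IsAlgebraicOfDegree ℚ[[x,y]] IsPolynomial 3 Q ×
    (y ^ 6 - x ^ 6 + 6 · y ^ 2 * x ^ 3 - 3 · y ^ 4 + 2 · x ^ 3 + 3 · y ^ 2 - 1#) * Q ^ 3
    + (x ^ 3 * y ^ 2 - y ^ 4 + x ^ 3 + 2 · y ^ 2 - 1#) * Q ^ 2
    + (x ^ 3 - y ^ 2 + 1#) * Q
    + 1#
    ≈ 0#) ×
    (let open Univariate in
    T ≈ diagonal Q ×
    IsAlgebraicOfDegree ℚ[[x]] IsPolynomial 3 T ×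
    (6 · x ^ 5 - 3 · x ^ 4 + 2 · x ^ 3 + 3 · x ^ 2 - 1#) * T ^ 3
    + (x ^ 5 - x ^ 4 + x ^ 3 + 2 · x ^ 2 - 1#) * T ^ 2
    + (x ^ 3 - x ^ 2 + 1#) * T
    + 1#
    ≈ 0#)
mainTheorem1 = (Main.Q-algebraic , Coefficients.IsRoot.equation Main.Q-isRoot) , Counting.T≈diagonal , Main.T-algebraic , Coefficients.IsDiagonalRoot.equation Main.T-isRoot
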